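{- Let $G$ be a graph on $n\ge 7$ vertices and let $r\ge 1$ be an integer with $r\le \log_2 n$. Then the $K_r$-count $\mathrm{k}_r(G)$ is reconstructible from $n-1$ cards.
   Context: Graphs are finite and simple. For a graph $G$ and $v\in V(G)$, the card $G-v$ is the unlabelled induced subgraph $G[V(G)\setminus\{v\}]$ (i.e. considered up to isomorphism). The deck $\mathcal{D}(G)$ is the multiset of all cards $G-v$, $v\in V(G)$. The $K_r$-count $\mathrm{k}_r(G)$ is the number of $r$-element vertex subsets of $G$ that induce a complete graph. A quantity $f(G)$ of an $n$-vertex graph $G$ is reconstructible from $n-1$ cards if for every graph $H$ which has at least $n-1$ cards in common with $G$ (decks compared as multisets of isomorphism classes) we have $f(H)=f(G)$. -}

module Defs where

open import Data.Bool.Base using (Bool; false; T)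
open import Data.Bool.Properties using (T?)
open import Data.Fin.Base using (Fin; punchIn)
open import Data.Fin.Permutation as Perm using (Permutation; _⟨$⟩ʳ_; _⟨$⟩ˡ_; inverseʳ)
open import Data.Fin.Properties using (_≟_; all?)
open import Data.Fin.Subset using (Subset; inside; outside; _∈_; ∣_∣)
open import Data.Fin.Subset.Properties using (_∈?_)
open import Data.List.Base using (List; []; [_]; _++_; map; filter; length; tabulate)
import Data.List.Relation.Binary.Permutation.Setoid as SetoidPermutation
open import Data.Nat.Base using (ℕ; zero; suc; _≤_)
import Data.Nat.Properties as ℕ
open import Data.Product.Base using (∃; ∃-syntax; _×_; _,_; proj₁; proj₂)
import Data.Vec.Base as Vec
open import Level using (0ℓ)
open import Relation.Binary.Bundles using (Setoid)
open import Relation.Binary.PropositionalEquality using (_≡_; _≢_; refl; sym; trans; cong₂)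
open import Relation.Nullary.Decidable using (Dec; _×-dec_; _→-dec_; ¬?)

-- A finite simple graph with vertex set Fin n, given by its adjacency matrix.
record Graph (n : ℕ) : Set where
  field
    adj       : Fin n → Fin n → Bool
    adj-sym   : ∀ u v → adj u v ≡ adj v u
    adj-irref : ∀ v → adj v v ≡ false

open Graph public

Adj : ∀ {n} → Graph n → Fin n → Fin n → Set
Adj G u v = T (adj G u v)

-- The number of vertices is not fixed in advance, so that graphs of different
-- orders can be compared.
FiniteGraph : Set
FiniteGraph = ∃ Graph

-- Permutation m n is the stdlib type of bijections Fin m ↔ Fin n.
infix 4 _≅_
record _≅_ (G H : FiniteGraph) : Set where
  constructor mk≅
  field
    bij      : Permutation (proj₁ G) (proj₁ H)
    adj-pres : ∀ u v → adj (proj₂ G) u v ≡ adj (proj₂ H) (bij ⟨$⟩ʳ u) (bij ⟨$⟩ʳ v)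

open _≅_ public

≅-refl : ∀ {G} → G ≅ G
≅-refl = mk≅ Perm.id λ _ _ → refl

≅-sym : ∀ {G H} → G ≅ H → H ≅ G
≅-sym {_ , G} {_ , H} (mk≅ π p) = mk≅ (Perm.flip π) λ u v →
  trans (cong₂ (adj H) (sym (inverseʳ π)) (sym (inverseʳ π)))
        (sym (p (π ⟨$⟩ˡ u) (π ⟨$⟩ˡ v)))

≅-trans : ∀ {G H K} → G ≅ H → H ≅ K → G ≅ K
≅-trans (mk≅ π p) (mk≅ ρ q) = mk≅ (π Perm.∘ₚ ρ) λ u v →
  trans (p u v) (q (π ⟨$⟩ʳ u) (π ⟨$⟩ʳ v))

-- Unlabelled graphs: finite graphs with isomorphism as equality.
unlabelledGraphs : Setoid 0ℓ 0ℓ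
unlabelledGraphs = record
  { Carrier       = FiniteGraph
  ; _≈_           = _≅_
  ; isEquivalence = record { refl = ≅-refl ; sym = ≅-sym ; trans = ≅-trans }
  }

-- G - v. The map punchIn v enumerates the vertices other than v.
_-ᵛ_ : ∀ {n} → Graph (suc n) → Fin (suc n) → Graph n
G -ᵛ v = record
  { adj       = λ i j → adj G (punchIn v i) (punchIn v j)
  ; adj-sym   = λ i j → adj-sym G (punchIn v i) (punchIn v j)
  ; adj-irref = λ i → adj-irref G (punchIn v i)
  }

-- A multiset of unlabelled graphs is a list of graphs, considered up to _↭_:
-- reordering and replacing entries by isomorphic graphs.
open SetoidPermutation unlabelledGraphs public using (_↭_)

deck : ∀ {n} → Graph n → List FiniteGraph
deck {zero}  G = []
deck {suc n} G = tabulate λ v → n , G -ᵛ v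

-- Inclusion of multisets, with multiplicities.
infix 4 _⊑_
_⊑_ : List FiniteGraph → List FiniteGraph → Set
C ⊑ D = ∃[ R ] (C ++ R) ↭ D

-- The multiset intersection of the two decks has at least k elements, i.e.
-- some multiset of at least k graphs is contained in both decks.
AtLeastCommonCards : ∀ {m n} → ℕ → Graph m → Graph n → Set
AtLeastCommonCards k G H =
  ∃[ C ] k ≤ length C × C ⊑ deck G × C ⊑ deck H

-- A quantity f takes values on graphs of every order. The graph H is not
-- assumed to have as many vertices as G.
ReconstructibleFrom : ∀ {A : Set} {n} → ℕ → (∀ {m} → Graph m → A) → Graph n → Set
ReconstructibleFrom k f G =
  ∀ {m} (H : Graph m) → AtLeastCommonCards k G H → f H ≡ f G

InducesComplete : ∀ {n} → Graph n → Subset n → Set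
InducesComplete G S = ∀ u v → u ∈ S → v ∈ S → u ≢ v → Adj G u v

inducesComplete? : ∀ {n} (G : Graph n) (S : Subset n) → Dec (InducesComplete G S)
inducesComplete? G S = all? λ u → all? λ v →
  (u ∈? S) →-dec ((v ∈? S) →-dec (¬? (u ≟ v) →-dec T? (adj G u v)))

-- Every subset of Fin n occurs exactly once.
subsets : ∀ n → List (Subset n)
subsets zero    = [ Vec.[] ]
subsets (suc n) = map (inside Vec.∷_) (subsets n) ++ map (outside Vec.∷_) (subsets n)

cliqueCount : ∀ {n} → ℕ → Graph n → ℕ
cliqueCount {n} r G =
  length (filter (λ S → (∣ S ∣ ℕ.≟ r) ×-dec inducesComplete? G S) (subsets n))

{-# OPTIONS --safe #-}
module Submission where

-- Common cards are matched up so that G - i ≅ H - i for all vertices i ≠ z, and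
-- the cliques of each size are shown to agree by induction on the size. If they
-- do not, Kelly's lemma gives, say, D G i = D H i + gap for all i ≠ z, where D
-- counts the cliques at a vertex, while D H z exceeds D G z by rest * gap.
--
-- The degrees (cliques of size 2) are handled by counting the vertices above a
-- given degree in all cards. For larger cliques the degrees agree already, and
-- one looks at the class C of vertices of maximal degree Δ: in the card at i the
-- vertices of degree Δ are the vertices of C not adjacent to i, so the multisets
-- of their values D agree for all i ≠ z. No vertex is dominating, as
-- inclusion-exclusion over smaller cliques would determine its D. A vertex of C
-- with largest value then forces z ∈ C, and the values on C form the arithmetic
-- progression D G z, D G z + gap, ..., D H z in both graphs. Hence C is complete in
-- H, and its vertices, having distinct values, have distinct neighbourhoods among
-- the at most r vertices outside C. As n ≥ 2 ^ r there are not enough of these.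

open import Defs
open import Data.Bool.Base using (Bool; true; false; not; _∧_; T)
open import Data.Bool.Properties
  using (T?; T-≡; T-∧; ¬-not; not-involutive; ∧-comm; ∧-assoc; ∧-zeroʳ; ∧-identityʳ; ∧-conicalˡ)
open import Data.Empty using (⊥)
open import Data.Fin.Base
  using (Fin; zero; suc; punchIn; toℕ; fromℕ; cast; join; splitAt; funToFin; finToFun)
open import Data.Fin.Permutation as Perm using (Permutation; _⟨$⟩ʳ_; _⟨$⟩ˡ_; inverseʳ)
open import Data.Fin.Properties
  using (_≟_; suc-injective; punchInᵢ≢i; injective⇒≤; toℕ<n; toℕ-injective; toℕ-cast; toℕ-fromℕ;
         cast-involutive; finToFun-funToFin; join-splitAt)
open import Data.Fin.Subset using (Subset; inside; outside; _∈_; ∣_∣)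
open import Data.List.Base using (List; []; _∷_; _++_; map; filter; length; lookup)
open import Data.List.Properties using (length-tabulate; lookup-tabulate)
open import Data.List.Relation.Binary.Permutation.Homogeneous using (onIndices)
open import Data.List.Relation.Binary.Permutation.Setoid.Properties unlabelledGraphs using (onIndices-lookup)
open import Data.Nat.Base
open import Data.Nat.Logarithm using (⌊log₂_⌋; ⌊log₂⌊n/2⌋⌋≡⌊log₂n⌋∸1)
open import Data.Nat.Properties hiding (_≟_; suc-injective)
open import Data.Nat.Tactic.RingSolver using (solve-∀)
open import Data.Product.Base using (∃; _×_; _,_; proj₁; proj₂)
open import Data.Sum.Base using (_⊎_; inj₁; inj₂)
open import Data.Vec.Base using ([]; _∷_; here; there)
open import Function.Base using (_∘_; case_of_)
open import Function.Bundles using (Equivalence; mk⇔)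
open import Relation.Binary.PropositionalEquality
open import Relation.Nullary using (Dec; yes; no; does; contradiction)
open import Relation.Nullary.Decidable using (dec-true; dec-false; does-⇔)
open import Relation.Unary using (Decidable)
open import Algebra.Properties.Semiring.Sum +-*-semiring
  using (sum; sum-remove; ∑-distrib-+; ∑-comm; sum-permute; sum-cong-≗; sum-replicate-zero;
         *-distribˡ-sum; *-distribʳ-sum)

-- Finite sums and indicator functions

-- For larger cliques `C` is the same set in both graphs because the degrees are already known; for
-- size 2 they are the unknowns, hence the separate argument. There the gap must be 1, which leaves
-- three possible degrees of z in G and linear equations between the numbers of vertices of
-- consecutive degrees. On seven vertices these admit an additional solution, which calls for the
-- complementary argument `one-large`. As the card at z is unknown, sums over `C` are known only up
-- to its contribution. Every vertex of `C` has the same number `q` of non-neighbours and so is seen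
-- in `q` cards, and the unknown contribution is below `q` once z has a non-neighbour outside `C`.
-- It is thus a remainder modulo `q` and can be split off. The final count is tight. At least n - r
-- of the n vertices lie in `C`, at most r outside, and an r-set has 2 ^ r - r - 1 subsets with two
-- or more elements, one too few already for n = 2 ^ r. This is where the bound r ≤ log₂ n comes
-- from.

⟦_⟧ : Bool → ℕ
⟦ true  ⟧ = 1
⟦ false ⟧ = 0

⟦∧⟧ : ∀ a b → ⟦ a ∧ b ⟧ ≡ ⟦ a ⟧ * ⟦ b ⟧
⟦∧⟧ true  b = sym (+-identityʳ ⟦ b ⟧)
⟦∧⟧ false b = refl

⟦⟧≤1 : ∀ a → ⟦ a ⟧ ≤ 1
⟦⟧≤1 true  = ≤-refl
⟦⟧≤1 false = z≤n

⟦⟧>0 : ∀ {a} → 0 < ⟦ a ⟧ → a ≡ true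
⟦⟧>0 {true} _ = refl

⟦not⟧ : ∀ a → ⟦ a ⟧ + ⟦ not a ⟧ ≡ 1
⟦not⟧ true  = refl
⟦not⟧ false = refl

*-pos : ∀ {m n} → 0 < m * n → 0 < m × 0 < n
*-pos {zero}  ()
*-pos {suc m} {zero}  p = contradiction (subst (0 <_) (*-zeroʳ m) p) λ ()
*-pos {suc m} {suc n} p = z<s , z<s

infix 4 _≠ᵇ_
_≠ᵇ_ : ∀ {n} → Fin n → Fin n → Bool
u ≠ᵇ v = not (does (u ≟ v))

≠ᵇ-refl : ∀ {n} (v : Fin n) → (v ≠ᵇ v) ≡ false
≠ᵇ-refl v rewrite dec-true (v ≟ v) refl = refl

≠ᵇ-true : ∀ {n} {u v : Fin n} → u ≢ v → (u ≠ᵇ v) ≡ true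
≠ᵇ-true {u = u} {v} p rewrite dec-false (u ≟ v) p = refl

≠ᵇ-sym : ∀ {n} (u v : Fin n) → (u ≠ᵇ v) ≡ (v ≠ᵇ u)
≠ᵇ-sym u v with u ≟ v
... | yes refl = sym (≠ᵇ-refl u)
... | no u≢v   = sym (≠ᵇ-true (u≢v ∘ sym))

≠ᵇ⇒≢ : ∀ {n} {u v : Fin n} → (u ≠ᵇ v) ≡ true → u ≢ v
≠ᵇ⇒≢ {v = v} p refl = case trans (sym (≠ᵇ-refl v)) p of λ ()

sum-except : ∀ {n} (v : Fin (suc n)) (f : Fin (suc n) → ℕ) →
  sum (λ u → ⟦ u ≠ᵇ v ⟧ * f u) ≡ sum (f ∘ punchIn v)
sum-except v f = trans (sum-remove {i = v} (λ u → ⟦ u ≠ᵇ v ⟧ * f u)) (cong₂ _+_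
  (cong (λ b → ⟦ b ⟧ * f v) (≠ᵇ-refl v))
  (sum-cong-≗ λ u → trans (cong (λ b → ⟦ b ⟧ * f (punchIn v u)) (≠ᵇ-true (punchInᵢ≢i v u)))
                          (+-identityʳ _)))

sum-split : ∀ {n} (v : Fin n) (f : Fin n → ℕ) →
  sum f ≡ f v + sum (λ u → ⟦ u ≠ᵇ v ⟧ * f u)
sum-split {suc n} v f = trans (sum-remove {i = v} f) (cong (f v +_) (sym (sum-except v f)))

sum-mono : ∀ {n} {f g : Fin n → ℕ} → (∀ i → f i ≤ g i) → sum f ≤ sum g
sum-mono {zero}  p = z≤n
sum-mono {suc n} p = +-mono-≤ (p zero) (sum-mono (p ∘ suc))

term≤sum : ∀ {n} (f : Fin n → ℕ) v → f v ≤ sum f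
term≤sum f v = subst (f v ≤_) (sym (sum-split v f)) (m≤m+n _ _)

two-terms≤sum : ∀ {n} (f : Fin n → ℕ) {u v} → u ≢ v → f u + f v ≤ sum f
two-terms≤sum f {u} {v} u≢v = subst (f u + f v ≤_) (sym (sum-split u f))
  (+-monoʳ-≤ (f u) (subst (_≤ sum g) gv (term≤sum g v)))
  where
  g = λ w → ⟦ w ≠ᵇ u ⟧ * f w
  gv : g v ≡ f v
  gv = trans (cong (λ b → ⟦ b ⟧ * f v) (≠ᵇ-true (u≢v ∘ sym))) (+-identityʳ _)

sum>0⇒∃ : ∀ {n} (f : Fin n → ℕ) → 0 < sum f → ∃ λ v → 0 < f v
sum>0⇒∃ {suc n} f p with f zero in eq
... | suc k = zero , subst (0 <_) (sym eq) z<s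
... | zero with sum>0⇒∃ (f ∘ suc) p
...   | v , q = suc v , q

sum-zero : ∀ {n} {f : Fin n → ℕ} → (∀ i → f i ≡ 0) → sum f ≡ 0
sum-zero {n} p = trans (sum-cong-≗ p) (sum-replicate-zero n)

sum-const : ∀ n c → sum {n} (λ _ → c) ≡ n * c
sum-const zero    c = refl
sum-const (suc n) c = cong (c +_) (sum-const n c)

-- Ordered cliques

N : ∀ {n} → Graph n → Fin n → Fin n → Bool
N G v u = adj G v u

infixl 7 _∖_ _∩_
_∩_ : ∀ {n} → (Fin n → Bool) → (Fin n → Bool) → Fin n → Bool
(P ∩ Q) u = P u ∧ Q u

_∖_ : ∀ {n} → (Fin n → Bool) → Fin n → Fin n → Bool
(P ∖ v) u = P u ∧ (u ≠ᵇ v)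

V : ∀ {n} → Fin n → Bool
V _ = true

-- The number of r-tuples of pairwise adjacent vertices in P, that is r ! times
-- the number of r-cliques.
κ : ∀ {n} → Graph n → ℕ → (Fin n → Bool) → ℕ
κ G zero    P = 1
κ G (suc r) P = sum λ v → ⟦ P v ⟧ * κ G r (P ∩ N G v)

κ-cong : ∀ {n} (G : Graph n) r {P Q} → (∀ u → P u ≡ Q u) → κ G r P ≡ κ G r Q
κ-cong G zero    e = refl
κ-cong G (suc r) e = sum-cong-≗ λ v →
  cong₂ (λ b k → ⟦ b ⟧ * k) (e v) (κ-cong G r λ u → cong (_∧ adj G v u) (e u))

κ-iso : ∀ {G H : FiniteGraph} (i : G ≅ H) r {P Q} → (∀ u → P u ≡ Q (bij i ⟨$⟩ʳ u)) →
  κ (proj₂ G) r P ≡ κ (proj₂ H) r Q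
κ-iso i zero    e = refl
κ-iso {_ , G} {_ , H} i (suc r) {P} {Q} e = trans
  (sum-cong-≗ λ v → cong₂ (λ b k → ⟦ b ⟧ * k) (e v)
     (κ-iso i r λ u → cong₂ _∧_ (e u) (adj-pres i v u)))
  (sym (sum-permute (λ v → ⟦ Q v ⟧ * κ H r (Q ∩ N H v)) (bij i)))

κ-card : ∀ {n} (G : Graph (suc n)) v r {P} → P v ≡ false →
  κ (G -ᵛ v) r (P ∘ punchIn v) ≡ κ G r P
κ-card G v zero    Pv = refl
κ-card G v (suc r) {P} Pv = sym (trans (sum-remove {i = v} (λ u → ⟦ P u ⟧ * κ G r (P ∩ N G u)))
  (cong₂ _+_ (cong (λ b → ⟦ b ⟧ * κ G r (P ∩ N G v)) Pv)
    (sum-cong-≗ λ u → cong (⟦ P (punchIn v u) ⟧ *_) (sym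
      (κ-card G v r {P ∩ N G (punchIn v u)} (cong (_∧ _) Pv))))))

∧-swapʳ : ∀ a b c → (a ∧ b) ∧ c ≡ (a ∧ c) ∧ b
∧-swapʳ a b c = trans (∧-assoc a b c) (trans (cong (a ∧_) (∧-comm b c)) (sym (∧-assoc a c b)))

-- An ordered clique that uses v has it in exactly one of its s places, and the other entries form
-- an ordered clique in `P ∩ N G v`. For s = 0 the factor s cancels the default value of `pred`.
κ-remove : ∀ {n} (G : Graph n) s P v →
  κ G s P ≡ κ G s (P ∖ v) + s * (⟦ P v ⟧ * κ G (pred s) (P ∩ N G v))
κ-remove G zero    P v = refl
κ-remove {n} G (suc s) P v = begin
  sum (λ u → ⟦ P u ⟧ * κ G s (P ∩ N G u))
    ≡⟨ sum-cong-≗ (λ u → trans (cong (⟦ P u ⟧ *_) (κ-remove G s (P ∩ N G u) v))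
                               (*-distribˡ-+ ⟦ P u ⟧ _ _)) ⟩
  sum (λ u → a u + b u)
    ≡⟨ ∑-distrib-+ a b ⟩
  sum a + sum b
    ≡⟨ cong₂ _+_ sum-a (sum-b s refl) ⟩
  (⟦ P v ⟧ * κ G s (P ∩ N G v) + κ G (suc s) (P ∖ v)) + s * (⟦ P v ⟧ * κ G s (P ∩ N G v))
    ≡⟨ rearrange (⟦ P v ⟧ * κ G s (P ∩ N G v)) (κ G (suc s) (P ∖ v)) s ⟩
  κ G (suc s) (P ∖ v) + suc s * (⟦ P v ⟧ * κ G s (P ∩ N G v)) ∎
  where
  open ≡-Reasoning
  -- For tuples with first entry u, `a` counts those without v in a later place and `b` those with v
  -- in a later place. In `sum a` the term u = v gives the tuples that start with v, and the rest
  -- gives those that avoid v.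
  a b : Fin _ → ℕ
  a u = ⟦ P u ⟧ * κ G s ((P ∩ N G u) ∖ v)
  b u = ⟦ P u ⟧ * (s * (⟦ (P ∩ N G u) v ⟧ * κ G (pred s) ((P ∩ N G u) ∩ N G v)))
  rearrange : ∀ x y z → (x + y) + z * x ≡ y + (x + z * x)
  rearrange = solve-∀
  v∉N : ∀ u → ((P ∩ N G v) ∖ v) u ≡ (P ∩ N G v) u
  v∉N u with u ≟ v
  ... | yes refl = trans (∧-zeroʳ _) (sym (trans (cong (P u ∧_) (adj-irref G u)) (∧-zeroʳ _)))
  ... | no  _    = ∧-identityʳ _
  sum-a : sum a ≡ ⟦ P v ⟧ * κ G s (P ∩ N G v) + κ G (suc s) (P ∖ v)
  sum-a = trans (sum-split v a) (cong₂ _+_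
    (cong (⟦ P v ⟧ *_) (κ-cong G s v∉N))
    (sum-cong-≗ λ u → trans (sym (*-assoc ⟦ u ≠ᵇ v ⟧ ⟦ P u ⟧ _)) (cong₂ _*_
      (trans (*-comm ⟦ u ≠ᵇ v ⟧ _) (sym (⟦∧⟧ (P u) _)))
      (κ-cong G s λ w → ∧-swapʳ (P w) (adj G u w) (w ≠ᵇ v)))))
  pull : ∀ x t y w k → x * (t * ((y * w) * k)) ≡ t * y * ((x * w) * k)
  pull = solve-∀
  sum-b : ∀ t → t ≡ s → sum b ≡ s * (⟦ P v ⟧ * κ G s (P ∩ N G v))
  sum-b zero    refl = sum-zero λ u → *-zeroʳ ⟦ P u ⟧
  sum-b (suc t) refl = begin
    sum b
      ≡⟨ sum-cong-≗ (λ u → begin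
           ⟦ P u ⟧ * (s * (⟦ P v ∧ adj G u v ⟧ * κ G t ((P ∩ N G u) ∩ N G v)))
             ≡⟨ cong (λ x → ⟦ P u ⟧ * (s * (x * κ G t ((P ∩ N G u) ∩ N G v)))) (⟦∧⟧ (P v) _) ⟩
           ⟦ P u ⟧ * (s * ((⟦ P v ⟧ * ⟦ adj G u v ⟧) * κ G t ((P ∩ N G u) ∩ N G v)))
             ≡⟨ pull ⟦ P u ⟧ s ⟦ P v ⟧ ⟦ adj G u v ⟧ _ ⟩
           s * ⟦ P v ⟧ * ((⟦ P u ⟧ * ⟦ adj G u v ⟧) * κ G t ((P ∩ N G u) ∩ N G v))
             ≡⟨ cong (λ x → s * ⟦ P v ⟧ * (x * κ G t ((P ∩ N G u) ∩ N G v)))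
                  (trans (cong (λ x → ⟦ P u ⟧ * ⟦ x ⟧) (adj-sym G u v)) (sym (⟦∧⟧ (P u) _))) ⟩
           s * ⟦ P v ⟧ * (⟦ (P ∩ N G v) u ⟧ * κ G t ((P ∩ N G u) ∩ N G v))
             ≡⟨ cong (λ x → s * ⟦ P v ⟧ * (⟦ (P ∩ N G v) u ⟧ * x))
                  (κ-cong G t λ w → ∧-swapʳ (P w) (adj G u w) (adj G v w)) ⟩
           s * ⟦ P v ⟧ * (⟦ (P ∩ N G v) u ⟧ * κ G t ((P ∩ N G v) ∩ N G u)) ∎) ⟩
    sum (λ u → s * ⟦ P v ⟧ * (⟦ (P ∩ N G v) u ⟧ * κ G t ((P ∩ N G v) ∩ N G u)))
      ≡⟨ *-distribˡ-sum {n} (s * ⟦ P v ⟧) _ ⟨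
    s * ⟦ P v ⟧ * κ G s (P ∩ N G v)
      ≡⟨ *-assoc s ⟦ P v ⟧ _ ⟩
    s * (⟦ P v ⟧ * κ G s (P ∩ N G v)) ∎

-- Clique counts in terms of ordered cliques

count : ∀ {A : Set} → (A → Bool) → List A → ℕ
count p []       = 0
count p (x ∷ xs) = ⟦ p x ⟧ + count p xs

count-++ : ∀ {A : Set} (p : A → Bool) xs ys → count p (xs ++ ys) ≡ count p xs + count p ys
count-++ p []       ys = refl
count-++ p (x ∷ xs) ys = trans (cong (⟦ p x ⟧ +_) (count-++ p xs ys)) (sym (+-assoc ⟦ p x ⟧ _ _))

count-map : ∀ {A B : Set} (p : B → Bool) (f : A → B) xs → count p (map f xs) ≡ count (p ∘ f) xs
count-map p f []       = refl
count-map p f (x ∷ xs) = cong (⟦ p (f x) ⟧ +_) (count-map p f xs)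

count-cong : ∀ {A : Set} {p q : A → Bool} → (∀ x → p x ≡ q x) → ∀ xs → count p xs ≡ count q xs
count-cong e []       = refl
count-cong e (x ∷ xs) = cong₂ (λ b → ⟦ b ⟧ +_) (e x) (count-cong e xs)

count-false : ∀ {A : Set} {p : A → Bool} → (∀ x → p x ≡ false) → ∀ xs → count p xs ≡ 0
count-false e []       = refl
count-false e (x ∷ xs) = cong₂ (λ b → ⟦ b ⟧ +_) (e x) (count-false e xs)

length-filter : ∀ {A : Set} {P : A → Set} (P? : Decidable P) xs →
  length (filter P? xs) ≡ count (does ∘ P?) xs
length-filter P? []       = refl
length-filter P? (x ∷ xs) with does (P? x)
... | true  = cong suc (length-filter P? xs)
... | false = length-filter P? xs

_⊆ᵇ_ : ∀ {n} → Subset n → (Fin n → Bool) → Bool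
[]            ⊆ᵇ P = true
(inside  ∷ S) ⊆ᵇ P = P zero ∧ S ⊆ᵇ (P ∘ suc)
(outside ∷ S) ⊆ᵇ P = S ⊆ᵇ (P ∘ suc)

-- Recursive along vertex `zero` like `subsets`, so that counting can be compared with `κ-remove` at
-- `zero`.
isComplete : ∀ {n} → Graph n → Subset n → Bool
isComplete G []            = true
isComplete G (inside  ∷ S) = S ⊆ᵇ (N G zero ∘ suc) ∧ isComplete (G -ᵛ zero) S
isComplete G (outside ∷ S) = isComplete (G -ᵛ zero) S

⊆ᵇ-∩ : ∀ {n} (S : Subset n) P Q → S ⊆ᵇ (P ∩ Q) ≡ S ⊆ᵇ P ∧ S ⊆ᵇ Q
⊆ᵇ-∩ []            P Q = refl
⊆ᵇ-∩ (outside ∷ S) P Q = ⊆ᵇ-∩ S (P ∘ suc) (Q ∘ suc)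
⊆ᵇ-∩ (inside  ∷ S) P Q rewrite ⊆ᵇ-∩ S (P ∘ suc) (Q ∘ suc) with P zero | Q zero
... | false | _     = refl
... | true  | true  = refl
... | true  | false = sym (∧-zeroʳ _)

⊆ᵇ-V : ∀ {n} (S : Subset n) → S ⊆ᵇ V ≡ true
⊆ᵇ-V []            = refl
⊆ᵇ-V (inside  ∷ S) = ⊆ᵇ-V S
⊆ᵇ-V (outside ∷ S) = ⊆ᵇ-V S

isCliqueIn : ∀ {n} → Graph n → ℕ → (Fin n → Bool) → Subset n → Bool
isCliqueIn G r P S = (∣ S ∣ ≡ᵇ r) ∧ (S ⊆ᵇ P ∧ isComplete G S)

-- Induction on the number of vertices: the subsets with and without vertex `zero` match the two
-- summands of `κ-remove` at `zero`, and the factor r there is the one by which r ! exceeds the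
-- previous factorial.
κ-cliques : ∀ {n} (G : Graph n) r P → r ! * count (isCliqueIn G r P) (subsets n) ≡ κ G r P
κ-cliques {zero}  G zero    P = refl
κ-cliques {zero}  G (suc r) P = *-zeroʳ (suc r !)
κ-cliques {suc n} G r P = begin
  r ! * count p (map (inside ∷_) (subsets n) ++ map (outside ∷_) (subsets n))
    ≡⟨ cong (r ! *_) (trans (count-++ p (map (inside ∷_) (subsets n)) _)
         (cong₂ _+_ (count-map p _ (subsets n)) (count-map p _ (subsets n)))) ⟩
  r ! * (count (p ∘ (inside ∷_)) (subsets n) + count (isCliqueIn G′ r P′) (subsets n))
    ≡⟨ *-distribˡ-+ (r !) _ _ ⟩
  r ! * count (p ∘ (inside ∷_)) (subsets n) + r ! * count (isCliqueIn G′ r P′) (subsets n)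
    ≡⟨ cong₂ _+_ (with-zero r refl) (κ-cliques G′ r P′) ⟩
  r * (⟦ P zero ⟧ * κ G (pred r) (P ∩ N G zero)) + κ G′ r P′
    ≡⟨ +-comm (r * (⟦ P zero ⟧ * κ G (pred r) (P ∩ N G zero))) _ ⟩
  κ G′ r P′ + r * (⟦ P zero ⟧ * κ G (pred r) (P ∩ N G zero))
    ≡⟨ cong (_+ r * (⟦ P zero ⟧ * κ G (pred r) (P ∩ N G zero)))
         (trans (κ-cong G′ r λ u → sym (∧-identity (P (suc u))))
                (κ-card G zero r {P ∖ zero} (∧-zeroʳ _))) ⟩
  κ G r (P ∖ zero) + r * (⟦ P zero ⟧ * κ G (pred r) (P ∩ N G zero))
    ≡⟨ κ-remove G r P zero ⟨
  κ G r P ∎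
  where
  open ≡-Reasoning
  G′ = G -ᵛ zero
  P′ = P ∘ suc
  p = isCliqueIn G r P
  ∧-identity : ∀ a → a ∧ true ≡ a
  ∧-identity true  = refl
  ∧-identity false = refl
  regroup : ∀ a x y s c → a ∧ ((x ∧ y) ∧ (s ∧ c)) ≡ x ∧ (a ∧ ((y ∧ s) ∧ c))
  regroup a true  y s c = cong (a ∧_) (sym (∧-assoc y s c))
  regroup a false y s c = ∧-zeroʳ a
  count-∧ : ∀ (b : Bool) (q : Subset n → Bool) xs → count (λ S → b ∧ q S) xs ≡ ⟦ b ⟧ * count q xs
  count-∧ true  q xs = sym (+-identityʳ _)
  count-∧ false q xs = count-false (λ _ → refl) xs
  pull : ∀ a b c d → (a * b) * (c * d) ≡ a * (c * (b * d))
  pull = solve-∀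
  with-zero : ∀ s → s ≡ r → r ! * count (p ∘ (inside ∷_)) (subsets n) ≡
                            r * (⟦ P zero ⟧ * κ G (pred r) (P ∩ N G zero))
  with-zero zero    refl = cong (1 *_) (count-false (λ _ → refl) (subsets n))
  with-zero (suc s) refl = begin
    (suc s * s !) * count (p ∘ (inside ∷_)) (subsets n)
      ≡⟨ cong (suc s * s ! *_) (trans (count-cong (λ S → trans
            (regroup (∣ S ∣ ≡ᵇ s) (P zero) (S ⊆ᵇ P′) _ _)
            (cong (λ x → P zero ∧ ((∣ S ∣ ≡ᵇ s) ∧ (x ∧ isComplete G′ S)))
                  (sym (⊆ᵇ-∩ S P′ (N G zero ∘ suc))))) (subsets n))
            (count-∧ (P zero) _ (subsets n))) ⟩
    (suc s * s !) * (⟦ P zero ⟧ * count (isCliqueIn G′ s (P′ ∩ (N G zero ∘ suc))) (subsets n))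
      ≡⟨ pull (suc s) (s !) ⟦ P zero ⟧ _ ⟩
    suc s * (⟦ P zero ⟧ * (s ! * count (isCliqueIn G′ s (P′ ∩ (N G zero ∘ suc))) (subsets n)))
      ≡⟨ cong (λ x → suc s * (⟦ P zero ⟧ * x)) (trans
           (κ-cliques G′ s (P′ ∩ (N G zero ∘ suc)))
           (κ-card G zero s {P ∩ N G zero} (trans (cong (P zero ∧_) (adj-irref G zero)) (∧-zeroʳ _)))) ⟩
    suc s * (⟦ P zero ⟧ * κ G s (P ∩ N G zero)) ∎

⊆ᵇ-sound : ∀ {n} (S : Subset n) {P} → T (S ⊆ᵇ P) → ∀ {u} → u ∈ S → T (P u)
⊆ᵇ-sound (inside  ∷ S) t here      = proj₁ (Equivalence.to T-∧ t)
⊆ᵇ-sound (inside  ∷ S) t (there i) = ⊆ᵇ-sound S (proj₂ (Equivalence.to T-∧ t)) i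
⊆ᵇ-sound (outside ∷ S) t (there i) = ⊆ᵇ-sound S t i

⊆ᵇ-complete : ∀ {n} (S : Subset n) {P} → (∀ {u} → u ∈ S → T (P u)) → T (S ⊆ᵇ P)
⊆ᵇ-complete []            f = _
⊆ᵇ-complete (inside  ∷ S) f = Equivalence.from T-∧ (f here , ⊆ᵇ-complete S (f ∘ there))
⊆ᵇ-complete (outside ∷ S) f = ⊆ᵇ-complete S (f ∘ there)

isComplete-sound : ∀ {n} (G : Graph n) S → T (isComplete G S) → InducesComplete G S
isComplete-sound G (inside ∷ S) t zero    zero    _ _ u≢v = contradiction refl u≢v
isComplete-sound G (inside ∷ S) t zero    (suc v) _ (there j) _ =
  ⊆ᵇ-sound S (proj₁ (Equivalence.to T-∧ t)) j
isComplete-sound G (inside ∷ S) t (suc u) zero    (there i) _ _ =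
  subst T (adj-sym G zero (suc u)) (⊆ᵇ-sound S (proj₁ (Equivalence.to T-∧ t)) i)
isComplete-sound G (inside ∷ S) t (suc u) (suc v) (there i) (there j) u≢v =
  isComplete-sound (G -ᵛ zero) S (proj₂ (Equivalence.to T-∧ t)) u v i j (u≢v ∘ cong suc)
isComplete-sound G (outside ∷ S) t (suc u) (suc v) (there i) (there j) u≢v =
  isComplete-sound (G -ᵛ zero) S t u v i j (u≢v ∘ cong suc)

isComplete-complete : ∀ {n} (G : Graph n) S → InducesComplete G S → T (isComplete G S)
isComplete-complete G []            c = _
isComplete-complete G (inside ∷ S)  c = Equivalence.from T-∧
  ( ⊆ᵇ-complete S (λ i → c zero _ here (there i) λ ())
  , isComplete-complete (G -ᵛ zero) S λ u v i j u≢v → c _ _ (there i) (there j) (u≢v ∘ suc-injective))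
isComplete-complete G (outside ∷ S) c =
  isComplete-complete (G -ᵛ zero) S λ u v i j u≢v → c _ _ (there i) (there j) (u≢v ∘ suc-injective)

does-inducesComplete : ∀ {n} (G : Graph n) S → does (inducesComplete? G S) ≡ isComplete G S
does-inducesComplete G S = does-⇔
  (mk⇔ (isComplete-complete G S) (isComplete-sound G S)) (inducesComplete? G S) (T? (isComplete G S))

κ-cliqueCount : ∀ {n} (G : Graph n) r → r ! * cliqueCount r G ≡ κ G r V
κ-cliqueCount {n} G r = trans (cong (r ! *_) (trans
  (length-filter _ (subsets n))
  (count-cong (λ S → cong ((∣ S ∣ ≡ᵇ r) ∧_)
     (trans (does-inducesComplete G S) (cong (_∧ isComplete G S) (sym (⊆ᵇ-V S))))) (subsets n))))
  (κ-cliques G r V)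

-- From common cards to a matching of the vertices

deck-permutation : ∀ {n xs} (G : Graph (suc n)) → xs ↭ deck G →
  ∃ λ (π : Permutation (length xs) (suc n)) → ∀ k → lookup xs k ≅ (n , G -ᵛ (π ⟨$⟩ʳ k))
deck-permutation {n} {xs} G p =
  onIndices p Perm.∘ₚ Perm.cast-id (length-tabulate cards) , λ k →
    subst (lookup xs k ≅_) (card (onIndices p ⟨$⟩ʳ k)) (onIndices-lookup p k)
  where
  cards = λ v → n , G -ᵛ v
  card : ∀ k → lookup (deck G) k ≡ (n , G -ᵛ (cast (length-tabulate cards) k))
  card k = trans
    (cong (lookup (deck G)) (sym (cast-involutive (sym (length-tabulate cards)) (length-tabulate cards) k)))
    (lookup-tabulate cards (cast (length-tabulate cards) k))

lookup-common-prefix : ∀ {A : Set} (C : List A) {R R′} k k′ → toℕ k ≡ toℕ k′ → toℕ k < length C →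
  lookup (C ++ R) k ≡ lookup (C ++ R′) k′
lookup-common-prefix (x ∷ C) zero    zero     _  _ = refl
lookup-common-prefix (x ∷ C) (suc k) (suc k′) e  l =
  lookup-common-prefix C k k′ (suc-cong e) (s<s⁻¹ l)
  where suc-cong = cong pred

-- The two decks are listed as `C ++ R` and `C ++ R′`, and H is relabelled so that equal positions
-- belong to equal vertices. Positions inside C carry the same graph in both lists; only the last
-- position can fall outside C, and z is the vertex of G there.
common-cards : ∀ {n m} (G : Graph (suc (suc n))) (H : Graph m) →
  AtLeastCommonCards (suc n) G H →
  ∃ λ z → ∃ λ (H′ : Graph (suc (suc n))) → (suc (suc n) , H′) ≅ (m , H) ×
    (∀ i → i ≢ z → (suc n , G -ᵛ i) ≅ (suc n , H′ -ᵛ i))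
common-cards {m = zero}  G H (c ∷ C , _ , _ , R , p) = contradiction (onIndices p) (Perm.refute λ ())
common-cards {n} {suc m} G H (C@(_ ∷ _) , |C|≥ , (R , p) , (R′ , p′)) = go m≡ H p′
  where
  πG = proj₁ (deck-permutation G p)
  -- The first entry of C is a card of both graphs, so its order fixes that of H.
  m≡ : m ≡ suc n
  m≡ = trans
    (sym (Perm.↔⇒≡ (bij (proj₂ (deck-permutation H p′) zero))))
    (Perm.↔⇒≡ (bij (proj₂ (deck-permutation G p) zero)))
  go : ∀ {m} → m ≡ suc n → (H : Graph (suc m)) → (C ++ R′) ↭ deck H →
    ∃ λ z → ∃ λ (H′ : Graph (suc (suc n))) → (suc (suc n) , H′) ≅ (suc m , H) ×
      (∀ i → i ≢ z → (suc n , G -ᵛ i) ≅ (suc n , H′ -ᵛ i))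
  go refl H p′ = πG ⟨$⟩ʳ last , H′ , mk≅ τ (λ _ _ → refl) , cards
    where
    πH = proj₁ (deck-permutation H p′)
    |CR|≡ : length (C ++ R) ≡ suc (suc n)
    |CR|≡ = Perm.↔⇒≡ πG
    |CR|≡|CR′| : length (C ++ R) ≡ length (C ++ R′)
    |CR|≡|CR′| = trans |CR|≡ (sym (Perm.↔⇒≡ πH))
    last = cast (sym |CR|≡) (fromℕ (suc n))
    τ = Perm.flip πG Perm.∘ₚ Perm.cast-id |CR|≡|CR′| Perm.∘ₚ πH
    H′ : Graph (suc (suc n))
    H′ = record
      { adj       = λ u v → adj H (τ ⟨$⟩ʳ u) (τ ⟨$⟩ʳ v)
      ; adj-sym   = λ u v → adj-sym H (τ ⟨$⟩ʳ u) (τ ⟨$⟩ʳ v)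
      ; adj-irref = λ u → adj-irref H (τ ⟨$⟩ʳ u)
      }
    relabel : ∀ i → (suc n , H′ -ᵛ i) ≅ (suc n , H -ᵛ (τ ⟨$⟩ʳ i))
    relabel i = mk≅ (Perm.remove i τ) λ u v →
      cong₂ (adj H) (Perm.punchIn-permute τ i u) (Perm.punchIn-permute τ i v)
    cards : ∀ i → i ≢ πG ⟨$⟩ʳ last → (suc n , G -ᵛ i) ≅ (suc n , H′ -ᵛ i)
    cards i i≢z = ≅-trans (≅-sym (subst (λ j → lookup (C ++ R) k ≅ (suc n , G -ᵛ j)) (inverseʳ πG)
                                    (proj₂ (deck-permutation G p) k)))
      (≅-trans (subst (_≅ (suc n , H -ᵛ (τ ⟨$⟩ʳ i)))
                  (sym (lookup-common-prefix C k k′ (sym (toℕ-cast |CR|≡|CR′| k)) k<|C|))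
                  (proj₂ (deck-permutation H p′) k′))
               (≅-sym (relabel i)))
      where
      k  = πG ⟨$⟩ˡ i
      k′ = cast |CR|≡|CR′| k
      k≢last : k ≢ last
      k≢last e = i≢z (trans (sym (inverseʳ πG)) (cong (πG ⟨$⟩ʳ_) e))
      k<|C| : toℕ k < length C
      k<|C| = ≤-trans (≤∧≢⇒< (s≤s⁻¹ (subst (toℕ k <_) |CR|≡ (toℕ<n k)))
        λ e → k≢last (toℕ-injective (trans e (sym (trans (toℕ-cast (sym |CR|≡) (fromℕ (suc n))) (toℕ-fromℕ (suc n))))))) |C|≥

cliqueCount-iso : ∀ {G H : FiniteGraph} → G ≅ H → ∀ r →
  cliqueCount r (proj₂ G) ≡ cliqueCount r (proj₂ H)
cliqueCount-iso {_ , G} {_ , H} i r = *-cancelˡ-≡ _ _ (r !) {{r !≢0}} (trans (κ-cliqueCount G r)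
  (trans (κ-iso i r λ _ → refl) (sym (κ-cliqueCount H r))))

-- Statistics of the common cards

opaque

  -- Up to the factor s !, the number of (s + 1)-cliques containing v.
  D : ∀ {n} → Graph n → ℕ → Fin n → ℕ
  D G s v = κ G s (N G v)

  -- The value of `D` at v in the card at i, written with the vertex names of the whole graph (see
  -- `D-card`). It has this meaning only for v ≢ i, hence the guards `j ≠ᵇ i` in the sums over a
  -- card.
  D∖ : ∀ {n} → Graph n → Fin n → ℕ → Fin n → ℕ
  D∖ G i s v = κ G s (N G v ∖ i)

  D-κ : ∀ {n} (G : Graph n) s v → D G s v ≡ κ G s (N G v)
  D-κ G s v = refl

record SameCards {n} (G H : Graph (suc n)) (z : Fin (suc n)) : Set where
  constructor sameCards
  field card≅ : ∀ i → i ≢ z → (n , G -ᵛ i) ≅ (n , H -ᵛ i)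

open SameCards public

SameCards-sym : ∀ {n} {G H : Graph (suc n)} {z} → SameCards G H z → SameCards H G z
SameCards-sym same = sameCards λ i i≢z → ≅-sym (card≅ same i i≢z)

opaque
  unfolding D

  κ-suc-V : ∀ {n} (G : Graph n) s → κ G (suc s) V ≡ sum (D G s)
  κ-suc-V G s = sum-cong-≗ λ v → +-identityʳ (D G s v)

  κ-V-remove : ∀ {n} (G : Graph n) s v → κ G s V ≡ κ G s (V ∖ v) + s * D G (pred s) v
  κ-V-remove G s v = trans (κ-remove G s V v) (cong (λ x → κ G s (V ∖ v) + s * x) (+-identityʳ _))

κ-V-card : ∀ {n} (G : Graph (suc n)) s i → κ (G -ᵛ i) s V ≡ κ G s (V ∖ i)
κ-V-card G s i = trans (κ-cong (G -ᵛ i) s λ u → sym (≠ᵇ-true (punchInᵢ≢i i u)))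
                       (κ-card G i s {V ∖ i} (≠ᵇ-refl i))

opaque
  unfolding D

  D-card : ∀ {n} (G : Graph (suc n)) s i u → D (G -ᵛ i) s u ≡ D∖ G i s (punchIn i u)
  D-card G s i u = trans
    (κ-cong (G -ᵛ i) s λ w → sym (trans (cong (N G (punchIn i u) (punchIn i w) ∧_) (≠ᵇ-true (punchInᵢ≢i i w)))
                                        (∧-identityʳ _)))
    (κ-card G i s {N G (punchIn i u) ∖ i} (trans (cong (N G (punchIn i u) i ∧_) (≠ᵇ-refl i)) (∧-zeroʳ _)))

  D-iso : ∀ {n} {G H : Graph n} (i : (n , G) ≅ (n , H)) s u → D G s u ≡ D H s (bij i ⟨$⟩ʳ u)
  D-iso i s u = κ-iso i s (adj-pres i u)

  D-∖ : ∀ {n} (G : Graph n) s i j →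
    D G s j ≡ D∖ G i s j + s * (⟦ adj G j i ⟧ * κ G (pred s) (N G j ∩ N G i))
  D-∖ G s i j = κ-remove G s (N G j) i

D-∖-nonadjacent : ∀ {n} (G : Graph n) s {i j} → adj G j i ≡ false → D∖ G i s j ≡ D G s j
D-∖-nonadjacent G s {i} {j} e = sym (trans (D-∖ G s i j) (trans
  (cong (λ b → D∖ G i s j + s * (⟦ b ⟧ * κ G (pred s) (N G j ∩ N G i))) e)
  (trans (cong (D∖ G i s j +_) (*-zeroʳ s)) (+-identityʳ _))))

degree-∖ : ∀ {n} (G : Graph n) i j → D G 1 j ≡ D∖ G i 1 j + ⟦ adj G j i ⟧
degree-∖ G i j = trans (D-∖ G 1 i j) (cong (D∖ G i 1 j +_) (trans (+-identityʳ _) (*-identityʳ _)))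

module _ {n} {G H : Graph (suc n)} {z} (same : SameCards G H z) where

  card-κ : ∀ s {i} → i ≢ z → κ G s (V ∖ i) ≡ κ H s (V ∖ i)
  card-κ s {i} i≢z = trans (sym (κ-V-card G s i)) (trans (κ-iso (card≅ same i i≢z) s λ _ → refl) (κ-V-card H s i))

  -- Isomorphic cards have the same multiset of pairs of a degree and a value of `D`. Equality of
  -- multisets is encoded by arbitrary test functions φ; indicators recover the multiplicities.
  card-sum : ∀ s (φ : ℕ → ℕ → ℕ) {i} → i ≢ z →
    sum (λ j → ⟦ j ≠ᵇ i ⟧ * φ (D∖ G i 1 j) (D∖ G i s j)) ≡
    sum (λ j → ⟦ j ≠ᵇ i ⟧ * φ (D∖ H i 1 j) (D∖ H i s j))
  card-sum s φ {i} i≢z = begin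
    sum (λ j → ⟦ j ≠ᵇ i ⟧ * φ (D∖ G i 1 j) (D∖ G i s j))
      ≡⟨ sum-except i (λ j → φ (D∖ G i 1 j) (D∖ G i s j)) ⟩
    sum (λ u → φ (D∖ G i 1 (punchIn i u)) (D∖ G i s (punchIn i u)))
      ≡⟨ sum-cong-≗ (λ u → cong₂ φ (trans (sym (D-card G 1 i u)) (D-iso iso 1 u))
                                   (trans (sym (D-card G s i u)) (D-iso iso s u))) ⟩
    sum (λ u → φ (D (H -ᵛ i) 1 (bij iso ⟨$⟩ʳ u)) (D (H -ᵛ i) s (bij iso ⟨$⟩ʳ u)))
      ≡⟨ sum-permute (λ u → φ (D (H -ᵛ i) 1 u) (D (H -ᵛ i) s u)) (bij iso) ⟨
    sum (λ u → φ (D (H -ᵛ i) 1 u) (D (H -ᵛ i) s u))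
      ≡⟨ sum-cong-≗ (λ u → cong₂ φ (D-card H 1 i u) (D-card H s i u)) ⟩
    sum (λ u → φ (D∖ H i 1 (punchIn i u)) (D∖ H i s (punchIn i u)))
      ≡⟨ sum-except i (λ j → φ (D∖ H i 1 j) (D∖ H i s j)) ⟨
    sum (λ j → ⟦ j ≠ᵇ i ⟧ * φ (D∖ H i 1 j) (D∖ H i s j)) ∎
    where
    open ≡-Reasoning
    iso = card≅ same i i≢z

-- The cliques avoiding i ≢ z are equally many in both graphs, so the excess at i reflects the
-- difference of the totals and is the same for all such i. These n vertices together have excess n
-- * `gap`, but the sums over all vertices differ by `suc s * gap` only, every clique being counted
-- at each of its `suc s` vertices. The vertex z compensates for the remaining `rest * gap`.
record Shift {n} (G H : Graph (suc n)) (z : Fin (suc n)) (s : ℕ) : Set where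
  field
    {gap}   : ℕ
    {rest}  : ℕ
    gap>0   : 0 < gap
    order   : n ≡ suc s + rest
    shifted : ∀ {j} → j ≢ z → D G s j ≡ D H s j + gap
    missing : D H s z ≡ D G s z + rest * gap

SameD : ∀ {n} → Graph n → Graph n → ℕ → Set
SameD G H s = ∀ j → D G s j ≡ D H s j

-- Kelly's lemma: all but one vertex have the same excess gap in D s, and
-- summing over all vertices determines the deficit of the remaining one.
shift-≥ : ∀ {n} {G H : Graph (suc (suc n))} {z} → SameCards G H z → ∀ s → suc s ≤ suc n →
  D H s (punchIn z zero) ≤ D G s (punchIn z zero) → SameD G H s ⊎ Shift G H z s
shift-≥ {n} {G} {H} {z} same s s≤n ≥₀ = conclude e refl
  where
  o = punchIn z zero
  o≢z : o ≢ z
  o≢z = punchInᵢ≢i z zero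
  L = suc n ∸ suc s
  order : suc n ≡ suc s + L
  order = sym (m+[n∸m]≡n s≤n)
  balance : ∀ {i} → i ≢ z → κ G (suc s) V + suc s * D H s i ≡ κ H (suc s) V + suc s * D G s i
  balance {i} i≢z = begin
    κ G (suc s) V + suc s * D H s i
      ≡⟨ cong (_+ suc s * D H s i) (κ-V-remove G (suc s) i) ⟩
    (κ G (suc s) (V ∖ i) + suc s * D G s i) + suc s * D H s i
      ≡⟨ cong (λ x → (x + suc s * D G s i) + suc s * D H s i) (card-κ same (suc s) i≢z) ⟩
    (κ H (suc s) (V ∖ i) + suc s * D G s i) + suc s * D H s i
      ≡⟨ swap (κ H (suc s) (V ∖ i)) (suc s * D G s i) (suc s * D H s i) ⟩
    (κ H (suc s) (V ∖ i) + suc s * D H s i) + suc s * D G s i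
      ≡⟨ cong (_+ suc s * D G s i) (κ-V-remove H (suc s) i) ⟨
    κ H (suc s) V + suc s * D G s i ∎
    where
    open ≡-Reasoning
    swap : ∀ a b c → (a + b) + c ≡ (a + c) + b
    swap = solve-∀
  e = D G s o ∸ D H s o
  o-eq : D G s o ≡ D H s o + e
  o-eq = sym (m+[n∸m]≡n ≥₀)
  K-eq : κ G (suc s) V ≡ κ H (suc s) V + suc s * e
  K-eq = +-cancelʳ-≡ (suc s * D H s o) _ _ (begin
    κ G (suc s) V + suc s * D H s o          ≡⟨ balance o≢z ⟩
    κ H (suc s) V + suc s * D G s o          ≡⟨ cong (λ x → κ H (suc s) V + suc s * x) o-eq ⟩
    κ H (suc s) V + suc s * (D H s o + e)    ≡⟨ expand (κ H (suc s) V) (suc s) (D H s o) e ⟩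
    (κ H (suc s) V + suc s * e) + suc s * D H s o ∎)
    where
    open ≡-Reasoning
    expand : ∀ k m d e → k + m * (d + e) ≡ (k + m * e) + m * d
    expand = solve-∀
  shifted : ∀ {j} → j ≢ z → D G s j ≡ D H s j + e
  shifted {j} j≢z = *-cancelˡ-≡ _ _ (suc s) (+-cancelˡ-≡ (κ H (suc s) V) _ _ (begin
    κ H (suc s) V + suc s * D G s j                ≡⟨ balance j≢z ⟨
    κ G (suc s) V + suc s * D H s j                ≡⟨ cong (_+ suc s * D H s j) K-eq ⟩
    (κ H (suc s) V + suc s * e) + suc s * D H s j  ≡⟨ expand (κ H (suc s) V) (suc s) (D H s j) e ⟨
    κ H (suc s) V + suc s * (D H s j + e)          ∎))
    where
    open ≡-Reasoning
    expand : ∀ k m d e → k + m * (d + e) ≡ (k + m * e) + m * d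
    expand = solve-∀
  R = sum (D H s ∘ punchIn z)
  missing : D H s z ≡ D G s z + L * e
  missing = +-cancelʳ-≡ (R + suc s * e) _ _ (begin
    D H s z + (R + suc s * e)
      ≡⟨ +-assoc (D H s z) R _ ⟨
    (D H s z + R) + suc s * e
      ≡⟨ cong (_+ suc s * e) (trans (κ-suc-V H s) (sum-remove {i = z} (D H s))) ⟨
    κ H (suc s) V + suc s * e
      ≡⟨ K-eq ⟨
    κ G (suc s) V
      ≡⟨ trans (κ-suc-V G s) (sum-remove {i = z} (D G s)) ⟩
    D G s z + sum (D G s ∘ punchIn z)
      ≡⟨ cong (D G s z +_) (trans (sum-cong-≗ λ u → shifted (punchInᵢ≢i z u))
           (trans (∑-distrib-+ (D H s ∘ punchIn z) (λ _ → e)) (cong (R +_) (sum-const (suc n) e)))) ⟩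
    D G s z + (R + suc n * e)
      ≡⟨ cong (λ m → D G s z + (R + m * e)) order ⟩
    D G s z + (R + (suc s + L) * e)
      ≡⟨ regroup (D G s z) R (suc s) L e ⟩
    (D G s z + L * e) + (R + suc s * e) ∎)
    where
    open ≡-Reasoning
    regroup : ∀ d r m l e → d + (r + (m + l) * e) ≡ (d + l * e) + (r + m * e)
    regroup = solve-∀
  conclude : ∀ g → g ≡ e → SameD G H s ⊎ Shift G H z s
  conclude (suc g) g≡e = inj₂ (record { gap>0 = subst (0 <_) g≡e z<s ; order = order ; shifted = shifted ; missing = missing })
  conclude zero    0≡e  = inj₁ λ j → case j ≟ z of λ where
    (no j≢z)   → trans (shifted j≢z) (trans (cong (D H s j +_) (sym 0≡e)) (+-identityʳ _))
    (yes refl) → sym (trans missing (trans (cong (λ x → D G s z + L * x) (sym 0≡e))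
                    (trans (cong (D G s z +_) (*-zeroʳ L)) (+-identityʳ _))))

sameD-or-shift : ∀ {n} {G H : Graph (suc (suc n))} {z} → SameCards G H z → ∀ s → suc s ≤ suc n →
  SameD G H s ⊎ Shift G H z s ⊎ Shift H G z s
sameD-or-shift {G = G} {H} {z} same s s≤n with ≤-total (D H s (punchIn z zero)) (D G s (punchIn z zero))
... | inj₁ ≥₀ with shift-≥ same s s≤n ≥₀
...   | inj₁ eq = inj₁ eq
...   | inj₂ sh = inj₂ (inj₁ sh)
sameD-or-shift {G = G} {H} {z} same s s≤n | inj₂ ≤₀
  with shift-≥ (SameCards-sym same) s s≤n ≤₀
...   | inj₁ eq = inj₁ (sym ∘ eq)
...   | inj₂ sh = inj₂ (inj₂ sh)

-- Numerical equality tests, maxima and enumerations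

≡ᵇ-sound : ∀ m n → (m ≡ᵇ n) ≡ true → m ≡ n
≡ᵇ-sound m n e = ≡ᵇ⇒≡ m n (Equivalence.from T-≡ e)

≡ᵇ-refl : ∀ n → (n ≡ᵇ n) ≡ true
≡ᵇ-refl n = Equivalence.to T-≡ (≡⇒≡ᵇ n n refl)

≡ᵇ-false : ∀ {m n} → m ≢ n → (m ≡ᵇ n) ≡ false
≡ᵇ-false {m} {n} m≢n with m ≡ᵇ n in eq
... | true  = contradiction (≡ᵇ-sound m n eq) m≢n
... | false = refl

_by_ : ∀ {A : Set} {a : Bool} → a ≡ false → a ≡ true → A
p by q = case trans (sym p) q of λ ()

opaque

  argmax : ∀ {n} (f : Fin (suc n) → ℕ) → ∃ λ m → ∀ j → f j ≤ f m
  argmax {zero}  f = zero , λ { zero → ≤-refl }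
  argmax {suc n} f with argmax (f ∘ suc)
  ... | m , max with ≤-total (f zero) (f (suc m))
  ...   | inj₁ le = suc m , λ { zero → le ; (suc j) → max j }
  ...   | inj₂ ge = zero  , λ { zero → ≤-refl ; (suc j) → ≤-trans (max j) ge }

  argmax-on : ∀ {n} (P : Fin (suc n) → Bool) (f : Fin (suc n) → ℕ) {v} → P v ≡ true →
    ∃ λ m → P m ≡ true × (∀ j → P j ≡ true → f j ≤ f m)
  -- The `suc` makes the weight positive on P even where f vanishes, so that the maximum is attained
  -- inside P.
  argmax-on P f {v} Pv with argmax (λ j → ⟦ P j ⟧ * suc (f j))
  ... | m , max = m , Pm , λ j Pj → s≤s⁻¹ (subst₂ _≤_ (value Pj) (value Pm) (max j))
    where
    value : ∀ {j} → P j ≡ true → ⟦ P j ⟧ * suc (f j) ≡ suc (f j)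
    value {j} Pj = trans (cong (λ b → ⟦ b ⟧ * suc (f j)) Pj) (+-identityʳ _)
    Pm : P m ≡ true
    Pm = ⟦⟧>0 (proj₁ (*-pos {⟦ P m ⟧} (≤-trans (≤-reflexive (cong ⟦_⟧ (sym Pv)))
           (≤-trans (≤-reflexive (sym (*-identityʳ _))) (≤-trans (*-monoʳ-≤ ⟦ P v ⟧ (s≤s z≤n)) (max v))))))

enumerate : ∀ {n} (P : Fin n → Bool) →
  ∃ λ (f : Fin (sum (⟦_⟧ ∘ P)) → Fin n) → ∀ v → P v ≡ true → ∃ λ k → f k ≡ v
enumerate {zero}  P = (λ ()) , λ ()
enumerate {suc n} P with P zero in P0 | enumerate (P ∘ suc)
... | false | f , onto = suc ∘ f , λ where
  zero    p → P0 by p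
  (suc v) p → proj₁ (onto v p) , cong suc (proj₂ (onto v p))
... | true  | f , onto = (λ { zero → zero ; (suc k) → suc (f k) }) , λ where
  zero    p → zero , refl
  (suc v) p → suc (proj₁ (onto v p)) , cong suc (proj₂ (onto v p))

injection⇒≤ : ∀ {k n} (P : Fin n → Bool) (f : Fin k → Fin n) → (∀ i → P (f i) ≡ true) →
  (∀ {i j} → f i ≡ f j → i ≡ j) → k ≤ sum (⟦_⟧ ∘ P)
injection⇒≤ P f Pf inj = injective⇒≤ {f = λ i → proj₁ (onto (f i) (Pf i))} λ {i} {j} e →
  inj (trans (sym (proj₂ (onto (f i) (Pf i)))) (trans (cong enum e) (proj₂ (onto (f j) (Pf j)))))
  where
  enum = proj₁ (enumerate P)
  onto = proj₂ (enumerate P)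

-- Non-neighbours

opaque

  NA : ∀ {n} → Graph n → Fin n → Fin n → Bool
  NA G i j = (j ≠ᵇ i) ∧ not (adj G i j)

  NA-sym : ∀ {n} (G : Graph n) i j → NA G i j ≡ NA G j i
  NA-sym G i j = cong₂ (λ a b → a ∧ not b) (≠ᵇ-sym j i) (adj-sym G i j)

  NA-irrefl : ∀ {n} (G : Graph n) {i j} → NA G i j ≡ true → i ≢ j
  NA-irrefl G {i} p refl = ≠ᵇ⇒≢ {u = i} (∧-conicalˡ _ _ p) refl

  NA⇒nonadjacent : ∀ {n} (G : Graph n) {i j} → NA G i j ≡ true → adj G i j ≡ false
  NA⇒nonadjacent G {i} {j} p with adj G i j
  ... | false = refl
  ... | true  = ∧-zeroʳ (j ≠ᵇ i) by p

  nonadjacent⇒NA : ∀ {n} (G : Graph n) {i j} → i ≢ j → adj G i j ≡ false → NA G i j ≡ true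
  nonadjacent⇒NA G i≢j e rewrite e | ≠ᵇ-true (i≢j ∘ sym) = refl

  ¬NA⇒adjacent : ∀ {n} (G : Graph n) {i j} → i ≢ j → NA G i j ≡ false → adj G i j ≡ true
  ¬NA⇒adjacent G {i} {j} i≢j e with adj G i j in eq
  ... | true  = refl
  ... | false = e by trans (∧-identityʳ _) (≠ᵇ-true (i≢j ∘ sym))

  adj-NA : ∀ {n} (G : Graph n) {i j} → i ≢ j → adj G i j ≡ not (NA G i j)
  adj-NA G {i} {j} i≢j rewrite ≠ᵇ-true (i≢j ∘ sym) = sym (not-involutive (adj G i j))

degree : ∀ {n} (G : Graph n) v → D G 1 v ≡ sum λ u → ⟦ adj G v u ⟧
degree G v = trans (D-κ G 1 v) (sum-cong-≗ λ u → *-identityʳ ⟦ adj G v u ⟧)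

nonDegree : ∀ {n} → Graph n → Fin n → ℕ
nonDegree G v = sum λ u → ⟦ NA G v u ⟧

opaque
  unfolding NA

  adj+NA : ∀ {n} (G : Graph n) v u → ⟦ adj G v u ⟧ + ⟦ NA G v u ⟧ ≡ ⟦ u ≠ᵇ v ⟧
  adj+NA G v u with u ≟ v
  ... | yes refl rewrite adj-irref G u = refl
  ... | no _ = ⟦not⟧ (adj G v u)

degree+nonDegree : ∀ {n} (G : Graph (suc n)) v → D G 1 v + nonDegree G v ≡ n
degree+nonDegree {n} G v = cong pred (begin
  suc (D G 1 v + nonDegree G v)
    ≡⟨ cong (λ x → suc (x + nonDegree G v)) (degree G v) ⟩
  suc (sum (λ u → ⟦ adj G v u ⟧) + sum (λ u → ⟦ NA G v u ⟧))
    ≡⟨ cong suc (∑-distrib-+ (λ u → ⟦ adj G v u ⟧) (λ u → ⟦ NA G v u ⟧)) ⟨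
  suc (sum (λ u → ⟦ adj G v u ⟧ + ⟦ NA G v u ⟧))
    ≡⟨ cong suc (sum-cong-≗ (λ u → trans (adj+NA G v u) (sym (*-identityʳ ⟦ u ≠ᵇ v ⟧)))) ⟩
  suc (sum λ u → ⟦ u ≠ᵇ v ⟧ * 1)
    ≡⟨ sum-split v (λ _ → 1) ⟨
  sum {suc n} (λ _ → 1)
    ≡⟨ trans (sum-const (suc n) 1) (*-identityʳ (suc n)) ⟩
  suc n ∎)
  where
  open ≡-Reasoning

⟦⟧*-witness : ∀ {n} (P Q : Fin n → Bool) (f : Fin n → ℕ) t →
  0 < sum (λ j → ⟦ P j ⟧ * (⟦ Q j ⟧ * ⟦ f j ≡ᵇ t ⟧)) →
  ∃ λ j → P j ≡ true × Q j ≡ true × f j ≡ t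
⟦⟧*-witness P Q f t p with sum>0⇒∃ (λ j → ⟦ P j ⟧ * (⟦ Q j ⟧ * ⟦ f j ≡ᵇ t ⟧)) p
... | j , q = j , ⟦⟧>0 (proj₁ (*-pos {⟦ P j ⟧} q))
                , ⟦⟧>0 (proj₁ (*-pos {⟦ Q j ⟧} (proj₂ (*-pos {⟦ P j ⟧} q))))
                , ≡ᵇ-sound _ _ (⟦⟧>0 (proj₂ (*-pos {⟦ Q j ⟧} (proj₂ (*-pos {⟦ P j ⟧} q)))))

⟦⟧*-positive : ∀ {n} (P Q : Fin n → Bool) (f : Fin n → ℕ) t {j} →
  P j ≡ true → Q j ≡ true → f j ≡ t →
  0 < sum (λ j → ⟦ P j ⟧ * (⟦ Q j ⟧ * ⟦ f j ≡ᵇ t ⟧))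
⟦⟧*-positive P Q f t {j} Pj Qj refl = ≤-trans (≤-reflexive (sym one))
  (term≤sum (λ j → ⟦ P j ⟧ * (⟦ Q j ⟧ * ⟦ f j ≡ᵇ t ⟧)) j)
  where
  one : ⟦ P j ⟧ * (⟦ Q j ⟧ * ⟦ f j ≡ᵇ f j ⟧) ≡ 1
  one rewrite Pj | Qj | ≡ᵇ-refl (f j) = refl

module _ {n} (X : Graph (suc n)) {Δ} (D≤Δ : ∀ j → D X 1 j ≤ Δ) where

  D∖<Δ : ∀ {i j} → adj X j i ≡ true → D∖ X i 1 j ≢ Δ
  D∖<Δ {i} {j} e refl = <-irrefl refl (≤-trans (≤-reflexive (sym
    (trans (degree-∖ X i j) (trans (cong (λ b → D∖ X i 1 j + ⟦ b ⟧) e) (+-comm (D∖ X i 1 j) 1))))) (D≤Δ j))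

  opaque
    unfolding NA

    -- In the card at i the neighbours of i lose one degree and drop below Δ. A non-neighbour of i
    -- shares no clique with i, so it keeps both its degree and its value.
    top-term : ∀ s (φ : ℕ → ℕ) i j →
      ⟦ j ≠ᵇ i ⟧ * (⟦ D∖ X i 1 j ≡ᵇ Δ ⟧ * φ (D∖ X i s j)) ≡
      ⟦ NA X i j ⟧ * (⟦ D X 1 j ≡ᵇ Δ ⟧ * φ (D X s j))
    top-term s φ i j with j ≠ᵇ i | adj X i j in e
    ... | false | _    = refl
    ... | true | true  = cong (λ b → 1 * (⟦ b ⟧ * φ (D∖ X i s j)))
                           (≡ᵇ-false (D∖<Δ {i} {j} (trans (adj-sym X j i) e)))
    ... | true | false = cong₂ (λ d d′ → 1 * (⟦ d ≡ᵇ Δ ⟧ * φ d′))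
                           (D-∖-nonadjacent X 1 (trans (adj-sym X j i) e))
                           (D-∖-nonadjacent X s (trans (adj-sym X j i) e))

-- The vertices of maximal degree

module TopClass {n} {G H : Graph (suc n)} {z} (same : SameCards G H z) (sameDegree : SameD G H 1)
                (s : ℕ) {Δ} (G≤Δ : ∀ j → D G 1 j ≤ Δ) where

  H≤Δ : ∀ j → D H 1 j ≤ Δ
  H≤Δ j = subst (_≤ Δ) (sameDegree j) (G≤Δ j)

  C : Fin (suc n) → Bool
  C j = D G 1 j ≡ᵇ Δ

  -- Sums over the vertices of degree Δ in the card at i.
  cardSum : Graph (suc n) → (ℕ → ℕ) → Fin (suc n) → ℕ
  cardSum X φ i = sum λ j → ⟦ NA X i j ⟧ * (⟦ C j ⟧ * φ (D X s j))

  opaque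

    cardSum-same : ∀ (φ : ℕ → ℕ) {i} → i ≢ z → cardSum G φ i ≡ cardSum H φ i
    cardSum-same φ {i} i≢z = begin
      sum (λ j → ⟦ NA G i j ⟧ * (⟦ D G 1 j ≡ᵇ Δ ⟧ * φ (D G s j)))
        ≡⟨ sum-cong-≗ (top-term G G≤Δ s φ i) ⟨
      sum (λ j → ⟦ j ≠ᵇ i ⟧ * (⟦ D∖ G i 1 j ≡ᵇ Δ ⟧ * φ (D∖ G i s j)))
        ≡⟨ card-sum same s (λ d d′ → ⟦ d ≡ᵇ Δ ⟧ * φ d′) i≢z ⟩
      sum (λ j → ⟦ j ≠ᵇ i ⟧ * (⟦ D∖ H i 1 j ≡ᵇ Δ ⟧ * φ (D∖ H i s j)))
        ≡⟨ sum-cong-≗ (top-term H H≤Δ s φ i) ⟩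
      sum (λ j → ⟦ NA H i j ⟧ * (⟦ D H 1 j ≡ᵇ Δ ⟧ * φ (D H s j)))
        ≡⟨ sum-cong-≗ (λ j → cong (λ d → ⟦ NA H i j ⟧ * (⟦ d ≡ᵇ Δ ⟧ * φ (D H s j))) (sym (sameDegree j))) ⟩
      cardSum H φ i ∎
      where open ≡-Reasoning

  opaque

    -- With the indicator of the single value `D G s j` as test function, a positive sum on one side
    -- yields a witness on the other.
    nonneighbour-G→H : ∀ {i j} → i ≢ z → NA G i j ≡ true → C j ≡ true →
      ∃ λ j′ → NA H i j′ ≡ true × C j′ ≡ true × D H s j′ ≡ D G s j
    nonneighbour-G→H {i} {j} i≢z na c = ⟦⟧*-witness (NA H i) C (D H s) (D G s j)
      (subst (0 <_) (cardSum-same (λ d → ⟦ d ≡ᵇ D G s j ⟧) {i} i≢z)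
        (⟦⟧*-positive (NA G i) C (D G s) (D G s j) na c refl))

  opaque

    nonneighbour-H→G : ∀ {i j} → i ≢ z → NA H i j ≡ true → C j ≡ true →
      ∃ λ j′ → NA G i j′ ≡ true × C j′ ≡ true × D G s j′ ≡ D H s j
    nonneighbour-H→G {i} {j} i≢z na c = ⟦⟧*-witness (NA G i) C (D G s) (D H s j)
      (subst (0 <_) (sym (cardSum-same (λ d → ⟦ d ≡ᵇ D H s j ⟧) {i} i≢z))
        (⟦⟧*-positive (NA H i) C (D H s) (D H s j) na c refl))

  -- Each vertex of `C` has this many non-neighbours, in G as in H.
  q : ℕ
  q = n ∸ Δ

  nonDegree-top : ∀ X → (∀ j → D X 1 j ≡ D G 1 j) → ∀ {j} → C j ≡ true → nonDegree X j ≡ q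
  nonDegree-top X eq {j} c = begin
    nonDegree X j                     ≡⟨ m+n∸m≡n (D X 1 j) (nonDegree X j) ⟨
    D X 1 j + nonDegree X j ∸ D X 1 j ≡⟨ cong₂ _∸_ (degree+nonDegree X j) (trans (eq j) (≡ᵇ-sound _ _ c)) ⟩
    q                                 ∎
    where open ≡-Reasoning

  nonDegree-G : ∀ {j} → C j ≡ true → nonDegree G j ≡ q
  nonDegree-G = nonDegree-top G λ _ → refl

  nonDegree-H : ∀ {j} → C j ≡ true → nonDegree H j ≡ q
  nonDegree-H = nonDegree-top H (sym ∘ sameDegree)

  p r : Graph (suc n) → Fin (suc n) → ℕ
  p X j = sum λ i → ⟦ NA X j i ⟧ * ⟦ C i ⟧
  r X j = sum λ i → ⟦ NA X j i ⟧ * ⟦ not (C i) ⟧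

  p+r : ∀ X j → p X j + r X j ≡ nonDegree X j
  p+r X j = trans (sym (∑-distrib-+ (λ i → ⟦ NA X j i ⟧ * ⟦ C i ⟧) (λ i → ⟦ NA X j i ⟧ * ⟦ not (C i) ⟧)))
    (sum-cong-≗ λ i → trans (sym (*-distribˡ-+ ⟦ NA X j i ⟧ ⟦ C i ⟧ ⟦ not (C i) ⟧))
      (trans (cong (⟦ NA X j i ⟧ *_) (⟦not⟧ (C i))) (*-identityʳ ⟦ NA X j i ⟧)))

  p-cardSum : ∀ X j → p X j ≡ cardSum X (λ _ → 1) j
  p-cardSum X j = sum-cong-≗ λ i → cong (⟦ NA X j i ⟧ *_) (sym (*-identityʳ ⟦ C i ⟧))

  -- Double counting: a vertex of `C` is seen with degree Δ in exactly those cards whose deleted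
  -- vertex is one of its `q` non-neighbours.
  cardSum-total : ∀ X → (∀ {j} → C j ≡ true → nonDegree X j ≡ q) → ∀ (φ : ℕ → ℕ) →
    sum (cardSum X φ) ≡ q * sum (λ j → ⟦ C j ⟧ * φ (D X s j))
  cardSum-total X nd φ = begin
    sum (λ i → sum λ j → ⟦ NA X i j ⟧ * (⟦ C j ⟧ * φ (D X s j)))
      ≡⟨ ∑-comm (λ i j → ⟦ NA X i j ⟧ * (⟦ C j ⟧ * φ (D X s j))) ⟩
    sum (λ j → sum λ i → ⟦ NA X i j ⟧ * (⟦ C j ⟧ * φ (D X s j)))
      ≡⟨ sum-cong-≗ (λ j → trans
           (sum-cong-≗ λ i → cong (λ b → ⟦ b ⟧ * (⟦ C j ⟧ * φ (D X s j))) (NA-sym X i j))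
           (sym (*-distribʳ-sum {suc n} (⟦ C j ⟧ * φ (D X s j)) (λ i → ⟦ NA X j i ⟧)))) ⟩
    sum (λ j → nonDegree X j * (⟦ C j ⟧ * φ (D X s j)))
      ≡⟨ sum-cong-≗ regular ⟩
    sum (λ j → q * (⟦ C j ⟧ * φ (D X s j)))
      ≡⟨ *-distribˡ-sum {suc n} q (λ j → ⟦ C j ⟧ * φ (D X s j)) ⟨
    q * sum (λ j → ⟦ C j ⟧ * φ (D X s j)) ∎
    where
    open ≡-Reasoning
    regular : ∀ j → nonDegree X j * (⟦ C j ⟧ * φ (D X s j)) ≡ q * (⟦ C j ⟧ * φ (D X s j))
    regular j with C j in c
    ... | true  = cong (_* (1 * φ (D X s j))) (nd c)
    ... | false = trans (*-zeroʳ (nonDegree X j)) (sym (*-zeroʳ q))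

  -- Summing over all cards, the missing one accounts for the difference.
  opaque

    class-balance : ∀ (φ : ℕ → ℕ) →
      q * sum (λ j → ⟦ C j ⟧ * φ (D G s j)) + cardSum H φ z ≡
      q * sum (λ j → ⟦ C j ⟧ * φ (D H s j)) + cardSum G φ z
    class-balance φ = begin
      q * sum (λ j → ⟦ C j ⟧ * φ (D G s j)) + cardSum H φ z
        ≡⟨ cong (_+ cardSum H φ z) (trans (sym (cardSum-total G nonDegree-G φ)) (sum-split z (cardSum G φ))) ⟩
      (cardSum G φ z + sum (λ i → ⟦ i ≠ᵇ z ⟧ * cardSum G φ i)) + cardSum H φ z
        ≡⟨ cong (λ x → (cardSum G φ z + x) + cardSum H φ z) (sum-cong-≗ away) ⟩
      (cardSum G φ z + sum (λ i → ⟦ i ≠ᵇ z ⟧ * cardSum H φ i)) + cardSum H φ z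
        ≡⟨ rotate (cardSum G φ z) _ (cardSum H φ z) ⟩
      (cardSum H φ z + sum (λ i → ⟦ i ≠ᵇ z ⟧ * cardSum H φ i)) + cardSum G φ z
        ≡⟨ cong (_+ cardSum G φ z) (trans (sym (sum-split z (cardSum H φ))) (cardSum-total H nonDegree-H φ)) ⟩
      q * sum (λ j → ⟦ C j ⟧ * φ (D H s j)) + cardSum G φ z ∎
      where
      open ≡-Reasoning
      rotate : ∀ a b c → (a + b) + c ≡ (c + b) + a
      rotate = solve-∀
      away : ∀ i → ⟦ i ≠ᵇ z ⟧ * cardSum G φ i ≡ ⟦ i ≠ᵇ z ⟧ * cardSum H φ i
      away i with i ≟ z
      ... | yes _  = refl
      ... | no i≢z = cong (1 *_) (cardSum-same φ {i} i≢z)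

  opaque

    -- For j ≢ z this counts the vertices of degree Δ in a common card. At z it follows from
    -- `class-balance` with a constant test function, for then both sums over `C` merely count `C`.
    p-same : ∀ j → p G j ≡ p H j
    p-same j with j ≟ z
    ... | no j≢z = trans (p-cardSum G j) (trans (cardSum-same (λ _ → 1) {j} j≢z) (sym (p-cardSum H j)))
    ... | yes refl = trans (p-cardSum G j) (trans
      (sym (+-cancelˡ-≡ (q * sum (λ j → ⟦ C j ⟧ * 1)) _ _ (class-balance (λ _ → 1)))) (sym (p-cardSum H j)))

  opaque

    r-same : ∀ {j} → C j ≡ true → r G j ≡ r H j
    r-same {j} c = +-cancelˡ-≡ (p G j) _ _ (trans (p+r G j) (trans (nonDegree-G c)
      (trans (sym (nonDegree-H c)) (trans (sym (p+r H j)) (cong (_+ r H j) (sym (p-same j)))))))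

  opaque

    -- If z lies in `C`, all cards at vertices outside `C` are common cards. Together they see a
    -- vertex j of `C` once for each non-neighbour of j outside `C`.
    r-balance : C z ≡ true → ∀ (φ : ℕ → ℕ) →
      sum (λ j → ⟦ C j ⟧ * (r G j * φ (D G s j))) ≡ sum (λ j → ⟦ C j ⟧ * (r H j * φ (D H s j)))
    r-balance Cz φ = trans (swapped G) (trans (sum-cong-≗ away) (sym (swapped H)))
      where
      away : ∀ i → ⟦ not (C i) ⟧ * cardSum G φ i ≡ ⟦ not (C i) ⟧ * cardSum H φ i
      away i with C i in c
      ... | true  = refl
      ... | false = cong (1 *_) (cardSum-same φ {i} λ { refl → c by Cz })
      pull : ∀ a b c d → a * (b * c * d) ≡ c * (b * (a * d))
      pull = solve-∀
      swapped : ∀ X → sum (λ j → ⟦ C j ⟧ * (r X j * φ (D X s j))) ≡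
                      sum (λ i → ⟦ not (C i) ⟧ * cardSum X φ i)
      swapped X = begin
        sum (λ j → ⟦ C j ⟧ * (r X j * φ (D X s j)))
          ≡⟨ sum-cong-≗ (λ j → trans
               (cong (⟦ C j ⟧ *_) (*-distribʳ-sum {suc n} (φ (D X s j)) (λ i → ⟦ NA X j i ⟧ * ⟦ not (C i) ⟧)))
               (*-distribˡ-sum {suc n} ⟦ C j ⟧ (λ i → ⟦ NA X j i ⟧ * ⟦ not (C i) ⟧ * φ (D X s j)))) ⟩
        sum (λ j → sum λ i → ⟦ C j ⟧ * (⟦ NA X j i ⟧ * ⟦ not (C i) ⟧ * φ (D X s j)))
          ≡⟨ ∑-comm (λ j i → ⟦ C j ⟧ * (⟦ NA X j i ⟧ * ⟦ not (C i) ⟧ * φ (D X s j))) ⟩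
        sum (λ i → sum λ j → ⟦ C j ⟧ * (⟦ NA X j i ⟧ * ⟦ not (C i) ⟧ * φ (D X s j)))
          ≡⟨ sum-cong-≗ (λ i → trans (sum-cong-≗ λ j → trans
               (pull ⟦ C j ⟧ ⟦ NA X j i ⟧ ⟦ not (C i) ⟧ (φ (D X s j)))
               (cong (λ b → ⟦ not (C i) ⟧ * (⟦ b ⟧ * (⟦ C j ⟧ * φ (D X s j)))) (NA-sym X j i)))
               (sym (*-distribˡ-sum {suc n} ⟦ not (C i) ⟧ (λ j → ⟦ NA X i j ⟧ * (⟦ C j ⟧ * φ (D X s j)))))) ⟩
        sum (λ i → ⟦ not (C i) ⟧ * cardSum X φ i) ∎
        where open ≡-Reasoning

-- Inequalities, neighbourhood formulas and word counts for the inductive step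

n+2≤2^n : ∀ n → 2 ≤ n → 2 + n ≤ 2 ^ n
n+2≤2^n 1 (s≤s ())
n+2≤2^n 2 _ = ≤-refl
n+2≤2^n (suc (suc (suc n))) _ = begin
  2 + (3 + n)             ≤⟨ m≤m+n (5 + n) (3 + n) ⟩
  (5 + n) + (3 + n)       ≡⟨ double n ⟩
  2 * (2 + (2 + n))       ≤⟨ *-monoʳ-≤ 2 (n+2≤2^n (suc (suc n)) (s≤s (s≤s z≤n))) ⟩
  2 ^ (3 + n)             ∎
  where
  open ≤-Reasoning
  double : ∀ n → (5 + n) + (3 + n) ≡ 2 * (2 + (2 + n))
  double = solve-∀

sum≡0⇒ : ∀ {n} (f : Fin n → ℕ) → sum f ≡ 0 → ∀ i → f i ≡ 0
sum≡0⇒ f e i = n≤0⇒n≡0 (subst (f i ≤_) e (term≤sum f i))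

⟦⟧*-cong : ∀ b {x y} → (b ≡ true → x ≡ y) → ⟦ b ⟧ * x ≡ ⟦ b ⟧ * y
⟦⟧*-cong true  e = cong (1 *_) (e refl)
⟦⟧*-cong false e = refl

⟦≠ᵇ⟧*-≤ : ∀ {n} (u v : Fin n) {x y} → (u ≢ v → x ≤ y) → ⟦ u ≠ᵇ v ⟧ * x ≤ y
⟦≠ᵇ⟧*-≤ u v le with u ≟ v
... | yes _  = z≤n
... | no u≢v = ≤-trans (≤-reflexive (+-identityʳ _)) (le u≢v)

⟦≡ᵇ⟧-shift : ∀ a {b g} t → b ≡ a + g → ⟦ a ≡ᵇ t ⟧ ≤ ⟦ b ≡ᵇ (t + g) ⟧
⟦≡ᵇ⟧-shift a {_} {g} t refl with a ≡ᵇ t in e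
... | false = z≤n
... | true  = ≤-reflexive (cong ⟦_⟧ (sym (trans (cong (λ x → x + g ≡ᵇ t + g) (≡ᵇ-sound a t e)) (≡ᵇ-refl (t + g)))))

≡-by-⇔ : ∀ {a b : Bool} → (a ≡ true → b ≡ true) → (b ≡ true → a ≡ true) → a ≡ b
≡-by-⇔ {true}          f g = sym (f refl)
≡-by-⇔ {false} {false} f g = refl
≡-by-⇔ {false} {true}  f g = g refl

not-false : ∀ b → ⟦ not b ⟧ ≡ 0 → b ≡ true
not-false true _ = refl

⟦⟧≡0 : ∀ {a} → ⟦ a ⟧ ≡ 0 → a ≡ false
⟦⟧≡0 {false} _ = refl

-- The s-cliques that avoid a dominating vertex all lie in its neighbourhood, so the total count and
-- smaller cliques determine its value.
D-dominating : ∀ {n} (X : Graph n) s {j} → nonDegree X j ≡ 0 → κ X s V ≡ D X s j + s * D X (pred s) j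
D-dominating X s {j} e = trans (κ-V-remove X s j) (cong (_+ s * D X (pred s) j) (trans (κ-cong X s neighbours) (sym (D-κ X s j))))
  where
  neighbours : ∀ u → (V ∖ j) u ≡ N X j u
  neighbours u with u ≟ j
  ... | yes refl = sym (adj-irref X u)
  ... | no u≢j = sym (¬NA⇒adjacent X (u≢j ∘ sym) (⟦⟧≡0 (sum≡0⇒ (λ u → ⟦ NA X j u ⟧) e u)))

nonDegree-unique : ∀ {n} (X : Graph n) {j a b} → nonDegree X j ≡ 1 → NA X j a ≡ true → NA X j b ≡ true → a ≡ b
nonDegree-unique X {j} {a} {b} e na nb with a ≟ b
... | yes a≡b = a≡b
... | no a≢b  = contradiction (≤-trans (≤-reflexive (cong₂ (λ x y → ⟦ x ⟧ + ⟦ y ⟧) (sym na) (sym nb)))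
                  (≤-trans (two-terms≤sum (λ u → ⟦ NA X j u ⟧) a≢b) (≤-reflexive e))) λ { (s≤s ()) }

nonDegree-another : ∀ {n} (X : Graph n) {j} → 2 ≤ nonDegree X j → ∀ a → ∃ λ b → b ≢ a × NA X j b ≡ true
nonDegree-another X {j} 2≤ a with sum>0⇒∃ (λ u → ⟦ u ≠ᵇ a ⟧ * ⟦ NA X j u ⟧)
  (+-cancelˡ-≤ 1 1 _ (≤-trans 2≤ (subst (_≤ 1 + sum (λ u → ⟦ u ≠ᵇ a ⟧ * ⟦ NA X j u ⟧))
    (sym (sum-split a (λ u → ⟦ NA X j u ⟧))) (+-monoˡ-≤ _ (⟦⟧≤1 (NA X j a))))))
... | b , p = b , ≠ᵇ⇒≢ (⟦⟧>0 (proj₁ (*-pos {⟦ b ≠ᵇ a ⟧} p))) , ⟦⟧>0 (proj₂ (*-pos {⟦ b ≠ᵇ a ⟧} p))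

-- A recursion in t that determines D X t j from the values at i alone.
D-one-nonneighbour : ∀ {n} (X : Graph n) t {i j} → nonDegree X j ≡ 1 → NA X j i ≡ true →
  κ X t V ≡ D X t j + t * D X (pred t) i + t * D X (pred t) j
D-one-nonneighbour X t {i} {j} e na = begin
  κ X t V
    ≡⟨ κ-V-remove X t j ⟩
  κ X t (V ∖ j) + t * D X (pred t) j
    ≡⟨ cong (_+ t * D X (pred t) j) (κ-remove X t (V ∖ j) i) ⟩
  κ X t (V ∖ j ∖ i) + t * (⟦ i ≠ᵇ j ⟧ * κ X (pred t) (V ∖ j ∩ N X i)) + t * D X (pred t) j
    ≡⟨ cong₂ (λ x y → x + t * y + t * D X (pred t) j) (trans (κ-cong X t neighbours) (sym (D-κ X t j)))
         (trans (cong (λ b → ⟦ b ⟧ * κ X (pred t) (V ∖ j ∩ N X i)) (≠ᵇ-true (i≢j)))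
           (trans (+-identityʳ _) (trans (κ-cong X (pred t) j∉N) (sym (D-κ X (pred t) i))))) ⟩
  D X t j + t * D X (pred t) i + t * D X (pred t) j ∎
  where
  open ≡-Reasoning
  i≢j : i ≢ j
  i≢j = NA-irrefl X na ∘ sym
  neighbours : ∀ u → (V ∖ j ∖ i) u ≡ N X j u
  neighbours u with u ≟ j | u ≟ i
  ... | yes refl | _        = sym (adj-irref X u)
  ... | no _     | yes refl = sym (NA⇒nonadjacent X na)
  ... | no u≢j   | no u≢i with adj X j u in eq
  ...   | true  = refl
  ...   | false = contradiction (nonDegree-unique X e (nonadjacent⇒NA X (u≢j ∘ sym) eq) na) u≢i
  j∉N : ∀ u → (V ∖ j ∩ N X i) u ≡ N X i u
  j∉N u with u ≟ j
  ... | no _     = refl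
  ... | yes refl = sym (trans (adj-sym X i u) (NA⇒nonadjacent X na))

-- The neighbours of j are the vertices of degree other than Δ in its card.
D-visible : ∀ {n} (X : Graph (suc n)) {Δ} → (∀ u → D X 1 u ≤ Δ) → ∀ s {j} →
  (∀ u → NA X j u ≡ true → D X 1 u ≡ Δ) →
  D X s j ≡ κ (X -ᵛ j) s (λ u → not (D (X -ᵛ j) 1 u ≡ᵇ Δ))
D-visible X {Δ} D≤Δ s {j} na-top = begin
  D X s j
    ≡⟨ trans (D-κ X s j) (κ-cong X s neighbours) ⟩
  κ X s P
    ≡⟨ κ-card X j s (cong (_∧ not (D∖ X j 1 j ≡ᵇ Δ)) (≠ᵇ-refl j)) ⟨
  κ (X -ᵛ j) s (P ∘ punchIn j)
    ≡⟨ κ-cong (X -ᵛ j) s (λ u → cong₂ (λ a d → a ∧ not (d ≡ᵇ Δ)) (≠ᵇ-true (punchInᵢ≢i j u)) (sym (D-card X 1 j u))) ⟩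
  κ (X -ᵛ j) s (λ u → not (D (X -ᵛ j) 1 u ≡ᵇ Δ)) ∎
  where
  open ≡-Reasoning
  P : Fin _ → Bool
  P u = (u ≠ᵇ j) ∧ not (D∖ X j 1 u ≡ᵇ Δ)
  neighbours : ∀ u → N X j u ≡ P u
  neighbours u with u ≟ j
  ... | yes refl = adj-irref X u
  ... | no u≢j with adj X j u in eq
  ...   | true  = sym (cong not (≡ᵇ-false (D∖<Δ X D≤Δ {j} {u} (trans (adj-sym X u j) eq))))
  ...   | false = sym (cong not (trans
            (cong (_≡ᵇ Δ) (trans (D-∖-nonadjacent X 1 {j} {u} (trans (adj-sym X u j) eq))
                                 (na-top u (nonadjacent⇒NA X (u≢j ∘ sym) eq))))
            (≡ᵇ-refl Δ)))

-- The neighbourhoods agree apart from u and v themselves, and the cliques through both vertices are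
-- counted at either one.
D-twins : ∀ {n} (X : Graph n) s {u v} → adj X u v ≡ true →
  (∀ w → w ≢ u → w ≢ v → adj X u w ≡ adj X v w) → D X s u ≡ D X s v
D-twins X s {u} {v} uv same = begin
  D X s u
    ≡⟨ trans (D-κ X s u) (κ-remove X s (N X u) v) ⟩
  κ X s (N X u ∖ v) + s * (⟦ adj X u v ⟧ * κ X (pred s) (N X u ∩ N X v))
    ≡⟨ cong₂ (λ x y → x + s * y) (κ-cong X s outer)
         (cong₂ (λ b k → ⟦ b ⟧ * k) (adj-sym X u v) (κ-cong X (pred s) λ w → ∧-comm (adj X u w) (adj X v w))) ⟩
  κ X s (N X v ∖ u) + s * (⟦ adj X v u ⟧ * κ X (pred s) (N X v ∩ N X u))
    ≡⟨ trans (D-κ X s v) (κ-remove X s (N X v) u) ⟨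
  D X s v ∎
  where
  open ≡-Reasoning
  outer : ∀ w → (N X u ∖ v) w ≡ (N X v ∖ u) w
  outer w with w ≟ u | w ≟ v
  ... | yes refl | yes refl = refl
  ... | yes refl | no _     = trans (∧-identityʳ _) (trans (adj-irref X w) (sym (∧-zeroʳ _)))
  ... | no _     | yes refl = trans (∧-zeroʳ _) (sym (trans (∧-identityʳ _) (adj-irref X w)))
  ... | no w≢u   | no w≢v   = cong (_∧ true) (same w w≢u w≢v)

quotient-unique : ∀ q {a b x y} → x < q → y < q → q * a + x ≡ q * b + y → a ≡ b
quotient-unique q x<q y<q e = ≤-antisym
  (≮⇒≥ λ b<a → <⇒≢ (strict y<q b<a) (sym e)) (≮⇒≥ λ a<b → <⇒≢ (strict x<q a<b) e)
  where
  strict : ∀ {a b x y} → x < q → a < b → q * a + x < q * b + y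
  strict {a} {b} {x} {y} x<q a<b = begin-strict
    q * a + x   <⟨ +-monoʳ-< (q * a) x<q ⟩
    q * a + q   ≡⟨ trans (+-comm (q * a) q) (sym (*-suc q a)) ⟩
    q * suc a   ≤⟨ *-monoʳ-≤ q a<b ⟩
    q * b       ≤⟨ m≤m+n (q * b) y ⟩
    q * b + y   ∎
    where open ≤-Reasoning

n+2^m≤2^[m+n] : ∀ m n → n + 2 ^ m ≤ 2 ^ (m + n)
n+2^m≤2^[m+n] m zero    = ≤-reflexive (cong (2 ^_) (sym (+-identityʳ m)))
n+2^m≤2^[m+n] m (suc n) = begin
  suc (n + 2 ^ m)                  ≤⟨ s≤s (n+2^m≤2^[m+n] m n) ⟩
  1 + 2 ^ (m + n)                  ≤⟨ +-monoˡ-≤ (2 ^ (m + n)) (m^n>0 2 (m + n)) ⟩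
  2 ^ (m + n) + 2 ^ (m + n)        ≡⟨ cong (2 ^ (m + n) +_) (+-identityʳ _) ⟨
  2 * 2 ^ (m + n)                  ≡⟨ cong (2 ^_) (+-suc m n) ⟨
  2 ^ (m + suc n)                  ∎
  where open ≤-Reasoning

distinct-words : ∀ {k m} (F : Fin k → Fin m → Bool) →
  (∀ {i j} → (∀ x → F i x ≡ F j x) → i ≡ j) → k ≤ 2 ^ m
distinct-words F inj = injective⇒≤ {f = λ i → funToFin (bit ∘ F i)} λ {i} {j} e → inj λ x →
  bit-injective (trans (sym (finToFun-funToFin (bit ∘ F i) x))
    (trans (cong (λ c → finToFun c x) e) (finToFun-funToFin (bit ∘ F j) x)))
  where
  bit : Bool → Fin 2
  bit false = zero
  bit true  = suc zero
  bit-injective : ∀ {a b} → bit a ≡ bit b → a ≡ b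
  bit-injective {false} {false} _ = refl
  bit-injective {true}  {true}  _ = refl

-- The empty word and the words with a single letter true are distinct from
-- words with two letters true.
distinct-large-words : ∀ {k m} (F : Fin k → Fin m → Bool) →
  (∀ {i j} → (∀ x → F i x ≡ F j x) → i ≡ j) →
  (∀ i → ∃ λ x → ∃ λ y → x ≢ y × F i x ≡ true × F i y ≡ true) → suc (m + k) ≤ 2 ^ m
distinct-large-words {k} {m} F inj two = distinct-words words words-injective
  where
  single : Fin m → Fin m → Bool
  single x y = does (x ≟ y)
  single-self : ∀ x → single x x ≡ true
  single-self x = dec-true (x ≟ x) refl
  single⇒≡ : ∀ x y → single x y ≡ true → x ≡ y
  single⇒≡ x y e with x ≟ y
  ... | yes x≡y = x≡y
  word : Fin m ⊎ Fin k → Fin m → Bool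
  word (inj₁ x) = single x
  word (inj₂ i) = F i
  words : Fin (suc (m + k)) → Fin m → Bool
  words zero    _ = false
  words (suc c)   = word (splitAt m c)
  nonempty : ∀ w → ∃ λ x → word w x ≡ true
  nonempty (inj₁ x) = x , single-self x
  nonempty (inj₂ i) = proj₁ (two i) , proj₁ (proj₂ (proj₂ (proj₂ (two i))))
  not-single : ∀ x i → (∀ y → F i y ≡ single x y) → ⊥
  not-single x i e with two i
  ... | a , b , a≢b , Fa , Fb = a≢b (trans (sym (single⇒≡ x a (trans (sym (e a)) Fa)))
                                          (single⇒≡ x b (trans (sym (e b)) Fb)))
  word-injective : ∀ w w′ → (∀ x → word w x ≡ word w′ x) → w ≡ w′
  word-injective (inj₁ x) (inj₁ y) e = cong inj₁ (sym (single⇒≡ y x (trans (sym (e x)) (single-self x))))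
  word-injective (inj₁ x) (inj₂ i) e = contradiction (not-single x i (sym ∘ e)) λ ()
  word-injective (inj₂ i) (inj₁ x) e = contradiction (not-single x i e) λ ()
  word-injective (inj₂ i) (inj₂ j) e = cong inj₂ (inj e)
  words-injective : ∀ {i j} → (∀ x → words i x ≡ words j x) → i ≡ j
  words-injective {zero}  {zero}  e = refl
  words-injective {zero}  {suc d} e with nonempty (splitAt m d)
  ... | x , t = sym (e x) by t
  words-injective {suc c} {zero}  e with nonempty (splitAt m c)
  ... | x , t = e x by t
  words-injective {suc c} {suc d} e = cong suc (trans (sym (join-splitAt m k c))
    (trans (cong (join m k) (word-injective (splitAt m c) (splitAt m d) e)) (join-splitAt m k d)))

-- The inductive step for cliques on at least three vertices

module Step {n} {G H : Graph (suc n)} {z} (same : SameCards G H z) (s : ℕ) (2≤s : 2 ≤ s)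
            (ih : ∀ {t} → t < s → SameD G H t) (big : 2 ^ suc s ≤ suc n) (shift : Shift G H z s) where

  open Shift shift

  κ-V-same : ∀ {t} → t ≤ s → κ G t V ≡ κ H t V
  κ-V-same {zero}  _   = refl
  κ-V-same {suc t} t<s = trans (κ-suc-V G t) (trans (sum-cong-≗ (ih t<s)) (sym (κ-suc-V H t)))

  pred-s<s : pred s < s
  pred-s<s = ≤-reflexive (suc-pred s {{>-nonZero (≤-trans (s≤s z≤n) 2≤s)}})

  s<rest : s < rest
  s<rest = +-cancelˡ-≤ (2 + s) (suc s) rest (begin
    2 + s + suc s         ≤⟨ n≤1+n _ ⟩
    suc (2 + s + suc s)   ≡⟨ double s ⟩
    2 * (2 + s)           ≤⟨ *-monoʳ-≤ 2 (n+2≤2^n s 2≤s) ⟩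
    2 ^ suc s             ≤⟨ big ⟩
    suc n                 ≡⟨ cong suc order ⟩
    2 + s + rest          ∎)
    where
    open ≤-Reasoning
    double : ∀ s → suc (2 + s + suc s) ≡ 2 * (2 + s)
    double = solve-∀

  m<m+gap : ∀ {m} → m < m + gap
  m<m+gap {m} = m<m+n m gap>0

  -- It therefore suffices for a contradiction to find one vertex whose value is determined by the
  -- common cards and the smaller cliques.
  D≢ : ∀ j → D G s j ≢ D H s j
  D≢ j e with j ≟ z
  ... | no j≢z   = <-irrefl (trans (sym e) (shifted j≢z)) m<m+gap
  ... | yes refl = <-irrefl (trans e missing)
                     (m<m+n (D G s j) (*-mono-≤ (≤-trans (s≤s z≤n) s<rest) gap>0))

  sameDegree : SameD G H 1
  sameDegree = ih 2≤s

  Δ : ℕ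
  Δ = D G 1 (proj₁ (argmax (D G 1)))

  open TopClass {z = z} same sameDegree s (proj₂ (argmax (D G 1)))

  no-dominating : ∀ j → nonDegree G j ≢ 0
  no-dominating j e = D≢ j (+-cancelʳ-≡ (s * D G (pred s) j) _ _ (begin
    D G s j + s * D G (pred s) j  ≡⟨ D-dominating G s e ⟨
    κ G s V                       ≡⟨ κ-V-same ≤-refl ⟩
    κ H s V                       ≡⟨ D-dominating H s eH ⟩
    D H s j + s * D H (pred s) j  ≡⟨ cong (λ x → D H s j + s * x) (ih pred-s<s j) ⟨
    D H s j + s * D G (pred s) j  ∎))
    where
    open ≡-Reasoning
    eH : nonDegree H j ≡ 0
    eH = +-cancelˡ-≡ (D H 1 j) _ _ (trans (degree+nonDegree H j) (trans (sym (degree+nonDegree G j))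
           (cong₂ _+_ (sameDegree j) e)))

  nonneighbour : ∀ j → ∃ λ i → NA G j i ≡ true
  nonneighbour j with sum>0⇒∃ (λ u → ⟦ NA G j u ⟧) (n≢0⇒n>0 (no-dominating j))
  ... | i , p = i , ⟦⟧>0 p

  top∈C : C (proj₁ (argmax (D G 1))) ≡ true
  top∈C = ≡ᵇ-refl Δ

  -- If z is not in `C`, let j in `C` maximise the value in H. Its value in G is larger by `gap` and
  -- so exceeds every value on `C` in H. But any non-neighbour i ≢ z of j has a card that shows this
  -- value, and the same card belongs to H. There remains the case that z is the only non-neighbour
  -- of j.
  z∈C : C z ≡ true
  z∈C with C z in Cz
  ... | true  = refl
  ... | false with argmax-on C (D H s) top∈C
  ...   | j , Cj , max = case excluded of λ ()
    where
    ∈C⇒≢z : ∀ {v} → C v ≡ true → v ≢ z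
    ∈C⇒≢z c refl = Cz by c
    none : ∀ {v} → C v ≡ true → D H s v ≢ D G s j
    none {v} c e = <-irrefl refl (≤-trans m<m+gap
      (≤-trans (≤-reflexive (sym (trans e (shifted (∈C⇒≢z Cj))))) (max v c)))
    excluded-by : ∀ {i} → i ≢ z → NA G j i ≡ true → ⊥
    excluded-by i≢z na with nonneighbour-G→H i≢z (trans (NA-sym G _ j) na) Cj
    ... | v , _ , c , e = none c e
    -- Now `q` is 1. Since `p` agrees at z, some v in `C` has z as its only non-neighbour in H, and
    -- `D-one-nonneighbour` gives j in G and v in H the same recursion, hence the same value.
    only-z : NA G j z ≡ true → nonDegree G j ≡ 1 → ⊥
    only-z na one = none Cv (sym (recursion s ≤-refl))
      where
      p>0 : 0 < p H z
      p>0 = subst (0 <_) (p-same z) (≤-trans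
        (≤-reflexive (sym (cong₂ (λ a b → ⟦ a ⟧ * ⟦ b ⟧) (trans (NA-sym G z j) na) Cj)))
        (term≤sum (λ i → ⟦ NA G z i ⟧ * ⟦ C i ⟧) j))
      w = sum>0⇒∃ (λ i → ⟦ NA H z i ⟧ * ⟦ C i ⟧) p>0
      v = proj₁ w
      Cv : C v ≡ true
      Cv = ⟦⟧>0 (proj₂ (*-pos {⟦ NA H z v ⟧} (proj₂ w)))
      na′ : NA H v z ≡ true
      na′ = trans (NA-sym H v z) (⟦⟧>0 (proj₁ (*-pos {⟦ NA H z v ⟧} (proj₂ w))))
      one′ : nonDegree H v ≡ 1
      one′ = trans (nonDegree-H Cv) (trans (sym (nonDegree-G Cj)) one)
      recursion : ∀ t → t ≤ s → D G t j ≡ D H t v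
      recursion zero    _   = trans (D-κ G 0 j) (sym (D-κ H 0 v))
      recursion (suc t) t<s = +-cancelʳ-≡ (suc t * D G t z) _ _ (+-cancelʳ-≡ (suc t * D G t j) _ _ (begin
        D G (suc t) j + suc t * D G t z + suc t * D G t j  ≡⟨ D-one-nonneighbour G (suc t) one na ⟨
        κ G (suc t) V                                      ≡⟨ κ-V-same t<s ⟩
        κ H (suc t) V                                      ≡⟨ D-one-nonneighbour H (suc t) one′ na′ ⟩
        D H (suc t) v + suc t * D H t z + suc t * D H t v
          ≡⟨ cong₂ (λ x y → D H (suc t) v + suc t * x + suc t * y) (ih t<s z) (recursion t (<⇒≤ t<s)) ⟨
        D H (suc t) v + suc t * D G t z + suc t * D G t j  ∎))
        where open ≡-Reasoning
    excluded : ⊥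
    excluded with nonneighbour j
    ... | i , na with i ≟ z
    ...   | no i≢z   = excluded-by i≢z na
    ...   | yes refl with nonDegree G j in one | nonDegree-another G {j}
    ...     | zero        | _       = no-dominating j one
    ...     | suc zero    | _       = only-z na one
    ...     | suc (suc d) | another with another (s≤s (s≤s z≤n)) z
    ...       | b , b≢z , nb = excluded-by b≢z nb

  -- Weighting values by `r` hides z if its weight is zero. By `r-balance` the weighted sums agree,
  -- while every other vertex of `C` contributes an excess of `gap` times its weight; so all weights
  -- on `C` vanish. A non-neighbour j of z in `C` then has all its non-neighbours in `C`, and its
  -- own card reveals its value by `D-visible`.
  r-z≢0 : r G z ≢ 0
  r-z≢0 rz = D≢ j (trans (D-visible G G≤Δ s (visible G (r≡0 Cj) (λ u → refl)))
    (trans (κ-iso (card≅ same j j≢z) s λ u → cong (λ d → not (d ≡ᵇ Δ)) (D-iso (card≅ same j j≢z) 1 u))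
      (sym (D-visible H H≤Δ s (visible H (trans (sym (r-same Cj)) (r≡0 Cj)) (sym ∘ sameDegree))))))
    where
    G≤Δ = proj₂ (argmax (D G 1))
    term : ∀ j → Dec (j ≡ z) → C j ≡ true → r G j * D G s j ≡ r H j * D H s j + r G j * gap
    term j (yes refl) c = trans (cong (_* D G s z) rz)
      (sym (cong₂ (λ x y → x * D H s z + y * gap) (trans (sym (r-same c)) rz) rz))
    term j (no j≢z)   c = trans (cong (r G j *_) (shifted j≢z)) (trans (*-distribˡ-+ (r G j) (D H s j) gap)
      (cong (λ x → x * D H s j + r G j * gap) (r-same c)))
    excess : ∀ j → ⟦ C j ⟧ * (r G j * D G s j) ≡ ⟦ C j ⟧ * (r H j * D H s j) + ⟦ C j ⟧ * (r G j * gap)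
    excess j = trans (⟦⟧*-cong (C j) (term j (j ≟ z))) (*-distribˡ-+ ⟦ C j ⟧ (r H j * D H s j) (r G j * gap))
    total : sum (λ j → ⟦ C j ⟧ * (r G j * gap)) ≡ 0
    total = +-cancelˡ-≡ (sum (λ j → ⟦ C j ⟧ * (r H j * D H s j))) _ _ (trans
      (sym (trans (sum-cong-≗ excess) (∑-distrib-+ (λ j → ⟦ C j ⟧ * (r H j * D H s j)) (λ j → ⟦ C j ⟧ * (r G j * gap)))))
      (trans (r-balance z∈C λ d → d) (sym (+-identityʳ _))))
    r≡0 : ∀ {j} → C j ≡ true → r G j ≡ 0
    r≡0 {j} c = n≤0⇒n≡0 (≮⇒≥ λ r>0 → <-irrefl refl (≤-trans
      (*-mono-≤ {1} {⟦ C j ⟧} (≤-reflexive (sym (cong ⟦_⟧ c))) (*-mono-≤ r>0 gap>0))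
      (≤-reflexive (sum≡0⇒ (λ j → ⟦ C j ⟧ * (r G j * gap)) total j))))
    w : ∃ λ j → 0 < ⟦ NA G z j ⟧ * ⟦ C j ⟧
    w = sum>0⇒∃ (λ j → ⟦ NA G z j ⟧ * ⟦ C j ⟧) (n≢0⇒n>0 λ pz →
      no-dominating z (trans (sym (p+r G z)) (cong₂ _+_ pz rz)))
    j = proj₁ w
    Cj : C j ≡ true
    Cj = ⟦⟧>0 (proj₂ (*-pos {⟦ NA G z j ⟧} (proj₂ w)))
    j≢z : j ≢ z
    j≢z = NA-irrefl G (⟦⟧>0 (proj₁ (*-pos {⟦ NA G z j ⟧} (proj₂ w)))) ∘ sym
    visible : ∀ X → r X j ≡ 0 → (∀ u → D X 1 u ≡ D G 1 u) → ∀ u → NA X j u ≡ true → D X 1 u ≡ Δ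
    visible X rj≡0 eq u na = trans (eq u) (≡ᵇ-sound _ _ (not-false (C u) (trans
      (sym (+-identityʳ _)) (trans (cong (λ b → ⟦ b ⟧ * ⟦ not (C u) ⟧) (sym na))
        (sum≡0⇒ (λ i → ⟦ NA X j i ⟧ * ⟦ not (C i) ⟧) rj≡0 u)))))

  p-z<q : p G z < q
  p-z<q = subst (p G z <_) (trans (p+r G z) (nonDegree-G z∈C)) (m<m+n (p G z) (n≢0⇒n>0 r-z≢0))

  -- The multiplicity of the value t on `C`. The trivial factor for `V` gives the sum the shape
  -- required by `⟦⟧*-witness`.
  S : Graph (suc n) → ℕ → ℕ
  S X t = sum λ j → ⟦ C j ⟧ * (⟦ V j ⟧ * ⟦ D X s j ≡ᵇ t ⟧)

  opaque

    -- In `class-balance` the contributions of the cards at z are at most `p` at z, hence below `q`.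
    -- They are remainders, and the quotients must agree.
    S-same : ∀ t → S G t ≡ S H t
    S-same t = quotient-unique q (≤-<-trans (cardSum≤p H) (subst (_< q) (p-same z) p-z<q))
      (≤-<-trans (cardSum≤p G) p-z<q) (class-balance λ d → 1 * ⟦ d ≡ᵇ t ⟧)
      where
      cardSum≤p : ∀ X → cardSum X (λ d → 1 * ⟦ d ≡ᵇ t ⟧) z ≤ p X z
      cardSum≤p X = sum-mono λ j → *-monoʳ-≤ ⟦ NA X z j ⟧ (≤-trans
        (*-monoʳ-≤ ⟦ C j ⟧ (≤-trans (≤-reflexive (+-identityʳ _)) (⟦⟧≤1 (D X s j ≡ᵇ t))))
        (≤-reflexive (*-identityʳ ⟦ C j ⟧)))

  opaque

    value-G→H : ∀ {j} → C j ≡ true → ∃ λ j′ → C j′ ≡ true × D H s j′ ≡ D G s j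
    value-G→H {j} c with ⟦⟧*-witness C V (D H s) (D G s j)
      (subst (0 <_) (S-same (D G s j)) (⟦⟧*-positive C V (D G s) (D G s j) {j} c refl refl))
    ... | j′ , c′ , _ , e = j′ , c′ , e

  opaque

    value-H→G : ∀ {j} → C j ≡ true → ∃ λ j′ → C j′ ≡ true × D G s j′ ≡ D H s j
    value-H→G {j} c with ⟦⟧*-witness C V (D G s) (D H s j)
      (subst (0 <_) (sym (S-same (D H s j))) (⟦⟧*-positive C V (D H s) (D H s j) {j} c refl refl))
    ... | j′ , c′ , _ , e = j′ , c′ , e

  opaque

    -- Were the maximum in H attained at m ≢ z, the value of m in G, larger by `gap`, would also
    -- occur on `C` in H.
    D-H≤ : ∀ {j} → C j ≡ true → D H s j ≤ D H s z
    D-H≤ {j} c with argmax-on C (D H s) z∈C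
    ... | m , Cm , max with m ≟ z
    ...   | yes refl = max j c
    ...   | no m≢z with value-G→H Cm
    ...     | m′ , Cm′ , e = contradiction (≤-trans (≤-reflexive (sym (trans e (shifted m≢z)))) (max m′ Cm′))
                               (<⇒≱ m<m+gap)

  opaque

    S-beyond : ∀ {t} → D H s z < t → S H t ≡ 0
    S-beyond {t} lt = n≤0⇒n≡0 (≮⇒≥ λ p → case ⟦⟧*-witness C V (D H s) t p of λ where
      (j , c , _ , e) → <⇒≱ lt (subst (_≤ D H s z) e (D-H≤ c)))

  -- Apart from z, the vertices of `C` with value t in H have value `t + gap` in G, and that value
  -- occurs equally often in H.
  S-step : ∀ t → S H t ≤ ⟦ D H s z ≡ᵇ t ⟧ + S H (t + gap)
  S-step t = subst₂ _≤_ (sym (sum-split z (λ j → ⟦ C j ⟧ * (1 * ⟦ D H s j ≡ᵇ t ⟧))))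
    (cong (⟦ D H s z ≡ᵇ t ⟧ +_) (S-same (t + gap)))
    (+-mono-≤ at-z (sum-mono away))
    where
    at-z : ⟦ C z ⟧ * (1 * ⟦ D H s z ≡ᵇ t ⟧) ≤ ⟦ D H s z ≡ᵇ t ⟧
    at-z = ≤-reflexive (trans (cong (λ b → ⟦ b ⟧ * (1 * ⟦ D H s z ≡ᵇ t ⟧)) z∈C)
      (trans (+-identityʳ _) (+-identityʳ _)))
    away : ∀ j → ⟦ j ≠ᵇ z ⟧ * (⟦ C j ⟧ * (1 * ⟦ D H s j ≡ᵇ t ⟧)) ≤ ⟦ C j ⟧ * (1 * ⟦ D G s j ≡ᵇ (t + gap) ⟧)
    away j = ⟦≠ᵇ⟧*-≤ j z λ j≢z → *-monoʳ-≤ ⟦ C j ⟧ (*-monoʳ-≤ 1 (⟦≡ᵇ⟧-shift (D H s j) t (shifted j≢z)))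

  opaque

    -- Iterating `S-step` climbs by `gap` until the maximum `D H s z` is exceeded. The summand for z
    -- is met at most once, and beyond it nothing is left. The number d bounds the climb.
    S≤1 : ∀ d t → D H s z < t + d → S H t ≤ 1
    S≤1 zero    t lt = ≤-trans (≤-reflexive (S-beyond (subst (D H s z <_) (+-identityʳ t) lt))) z≤n
    S≤1 (suc d) t lt = bound (D H s z ≡ᵇ t) refl (S-step t)
      where
      open ≤-Reasoning
      bound : ∀ b → (D H s z ≡ᵇ t) ≡ b → S H t ≤ ⟦ D H s z ≡ᵇ t ⟧ + S H (t + gap) → S H t ≤ 1
      bound false e step = begin
        S H t                                   ≤⟨ step ⟩
        ⟦ D H s z ≡ᵇ t ⟧ + S H (t + gap)        ≡⟨ cong (λ b → ⟦ b ⟧ + S H (t + gap)) e ⟩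
        S H (t + gap)                           ≤⟨ S≤1 d (t + gap) (≤-trans lt (begin
          t + suc d     ≤⟨ +-monoʳ-≤ t (+-monoˡ-≤ d gap>0) ⟩
          t + (gap + d) ≡⟨ +-assoc t gap d ⟨
          t + gap + d   ∎)) ⟩
        1                                       ∎
      bound true  e step = begin
        S H t                                   ≤⟨ step ⟩
        ⟦ D H s z ≡ᵇ t ⟧ + S H (t + gap)        ≤⟨ +-monoˡ-≤ _ (⟦⟧≤1 (D H s z ≡ᵇ t)) ⟩
        1 + S H (t + gap)                       ≡⟨ cong suc (S-beyond
                                                     (subst (_< t + gap) (sym (≡ᵇ-sound _ _ e)) m<m+gap)) ⟩
        1                                       ∎

  distinct : ∀ X → (∀ t → S X t ≤ 1) → ∀ {u v} → C u ≡ true → C v ≡ true → D X s u ≡ D X s v → u ≡ v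
  distinct X S≤1 {u} {v} cu cv e with u ≟ v
  ... | yes u≡v = u≡v
  ... | no u≢v  = contradiction (≤-trans (≤-trans (≤-reflexive (sym (cong₂ _+_ (one cu refl) (one cv (sym e)))))
                    (two-terms≤sum (λ j → ⟦ C j ⟧ * (1 * ⟦ D X s j ≡ᵇ D X s u ⟧)) u≢v)) (S≤1 (D X s u)))
                    λ { (s≤s ()) }
    where
    one : ∀ {w} → C w ≡ true → D X s w ≡ D X s u → ⟦ C w ⟧ * (1 * ⟦ D X s w ≡ᵇ D X s u ⟧) ≡ 1
    one {w} c e = cong₂ (λ a b → ⟦ a ⟧ * (1 * ⟦ b ⟧)) c (trans (cong (_≡ᵇ D X s u) e) (≡ᵇ-refl (D X s u)))

  opaque

    distinct-H : ∀ {u v} → C u ≡ true → C v ≡ true → D H s u ≡ D H s v → u ≡ v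
    distinct-H = distinct H λ t → S≤1 (suc (D H s z)) t (m≤n+m (suc (D H s z)) t)

  opaque

    distinct-G : ∀ {u v} → C u ≡ true → C v ≡ true → D G s u ≡ D G s v → u ≡ v
    distinct-G = distinct G λ t → subst (_≤ 1) (sym (S-same t)) (S≤1 (suc (D H s z)) t (m≤n+m (suc (D H s z)) t))

  -- Level 0 is the value of z in G and, by `missing`, level `rest` is the value of z in H. Every
  -- other vertex is one level higher in G than in H.
  level : ℕ → ℕ
  level k = D G s z + k * gap

  level-suc : ∀ k → level k + gap ≡ level (suc k)
  level-suc k = trans (+-assoc (D G s z) (k * gap) gap) (cong (D G s z +_) (+-comm (k * gap) gap))

  level-injective : ∀ {k l} → level k ≡ level l → k ≡ l
  level-injective {k} {l} e = *-cancelʳ-≡ k l gap {{>-nonZero gap>0}} (+-cancelˡ-≡ (D G s z) _ _ e)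

  D-G-z : D G s z ≡ level 0
  D-G-z = sym (+-identityʳ _)

  level⇒≢z : ∀ {j k} → D G s j ≡ level (suc k) → j ≢ z
  level⇒≢z {k = k} e refl with level-injective {0} {suc k} (trans (sym D-G-z) e)
  ... | ()

  level-pred : ∀ {j k} → D G s j ≡ level (suc k) → D H s j ≡ level k
  level-pred {j} {k} e = +-cancelʳ-≡ gap _ _ (trans (sym (shifted (level⇒≢z {j} {k} e))) (trans e (sym (level-suc k))))

  opaque

    -- Descent from z, which has level `rest` in H: a vertex of level k + 1 in H gives one in G, and
    -- this one is not z, so it has level k in H.
    level-attained : ∀ d k → k + d ≡ rest → ∃ λ j → C j ≡ true × D H s j ≡ level k
    level-attained zero    k e = z , z∈C , trans missing (cong level (trans (sym e) (+-identityʳ k)))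
    level-attained (suc d) k e with level-attained d (suc k) (trans (sym (+-suc k d)) e)
    ... | j , c , ej with value-H→G c
    ...   | j′ , c′ , ej′ = j′ , c′ , level-pred {j′} {k} (trans ej′ ej)

  opaque

    -- Ascent to z: for j ≢ z the value in G is a larger value that occurs in H, so by recursion it
    -- is a level. It is not level 0, which in G belongs to z alone.
    only-levels : ∀ d {j} → C j ≡ true → D H s z < D H s j + d → ∃ λ k → k ≤ rest × D H s j ≡ level k
    only-levels zero    {j} c lt = contradiction (D-H≤ c) (<⇒≱ (subst (D H s z <_) (+-identityʳ _) lt))
    only-levels (suc d) {j} c lt with j ≟ z
    ... | yes refl = rest , ≤-refl , missing
    ... | no j≢z with value-G→H c
    ...   | j′ , c′ , e with only-levels d c′ (≤-trans lt (begin
            D H s j + suc d       ≤⟨ +-monoʳ-≤ (D H s j) (+-monoˡ-≤ d gap>0) ⟩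
            D H s j + (gap + d)   ≡⟨ +-assoc (D H s j) gap d ⟨
            D H s j + gap + d     ≡⟨ cong (_+ d) (trans e (shifted j≢z)) ⟨
            D H s j′ + d          ∎))
      where open ≤-Reasoning
    ...     | zero  , _ , e′ = contradiction (distinct-G c z∈C (trans (sym e) (trans e′ (sym D-G-z)))) j≢z
    ...     | suc k , k<rest , e′ = k , <⇒≤ k<rest , level-pred {j} {k} (trans (sym e) e′)

  -- A pair of non-neighbours in C at levels a and b > a of H is also present in
  -- G, and hence H has such a pair at levels a + 1 and b - 1.
  no-NA-levels : ∀ g a {u v} → C u ≡ true → C v ≡ true → NA H u v ≡ true →
    D H s u ≡ level a → D H s v ≡ level (a + g) → a + g ≤ rest → ⊥
  no-NA-levels zero    a cu cv na eu ev le =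
    NA-irrefl H na (distinct-H cu cv (trans eu (trans (cong level (sym (+-identityʳ a))) (sym ev))))
  no-NA-levels (suc g) a {u} {v} cu cv na eu ev le with nonneighbour-H→G u≢z na cv
    where
    a<rest = ≤-trans (≤-trans (s≤s (m≤m+n a g)) (≤-reflexive (sym (+-suc a g)))) le
    u≢z : u ≢ z
    u≢z refl = <⇒≢ a<rest (level-injective (trans (sym eu) missing))
  ... | j , na′ , cj , ej = split g refl
    where
    ej′ : D G s j ≡ level (suc (a + g))
    ej′ = trans ej (trans ev (cong level (+-suc a g)))
    eu′ : D G s u ≡ level (suc a)
    eu′ = trans (shifted λ { refl → <⇒≢ (≤-trans (≤-trans (s≤s (m≤m+n a g)) (≤-reflexive (sym (+-suc a g)))) le)
                                      (level-injective (trans (sym eu) missing)) })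
                (trans (cong (_+ gap) eu) (level-suc a))
    split : ∀ h → h ≡ g → ⊥
    split zero    refl = NA-irrefl G na′ (distinct-G cu cj (trans eu′ (trans (cong (level ∘ suc) (sym (+-identityʳ a))) (sym ej′))))
    split (suc h) refl with nonneighbour-G→H (level⇒≢z {j} {a + g} ej′) (trans (NA-sym G j u) na′) cu
    ... | w , naw , cw , ew = no-NA-levels h (suc a) cw cj (trans (NA-sym H w j) naw) (trans ew eu′)
            (trans (level-pred {j} {a + g} ej′) (cong level (+-suc a h)))
            (≤-trans (≤-trans (n≤1+n _) (≤-reflexive (sym (trans (+-suc a (suc h)) (cong suc (+-suc a h)))))) le)

  C-complete : ∀ {u v} → C u ≡ true → C v ≡ true → NA H u v ≡ true → ⊥
  C-complete {u} {v} cu cv na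
    with only-levels (suc (D H s z)) cu (m≤n+m _ (D H s u)) | only-levels (suc (D H s z)) cv (m≤n+m _ (D H s v))
  ... | a , a≤ , ea | b , b≤ , eb with ≤-total a b
  ...   | inj₁ a≤b = no-NA-levels (b ∸ a) a cu cv na ea
                       (trans eb (cong level (sym (m+[n∸m]≡n a≤b)))) (subst (_≤ rest) (sym (m+[n∸m]≡n a≤b)) b≤)
  ...   | inj₂ b≤a = no-NA-levels (a ∸ b) b cv cu (trans (NA-sym H v u) na) eb
                       (trans ea (cong level (sym (m+[n∸m]≡n b≤a)))) (subst (_≤ rest) (sym (m+[n∸m]≡n b≤a)) a≤)

  C-adjacent : ∀ {u v} → C u ≡ true → C v ≡ true → u ≢ v → adj H u v ≡ true
  C-adjacent cu cv u≢v = ¬NA⇒adjacent H u≢v (¬-not (C-complete cu cv))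

  -- As `C` is complete in H, such vertices are adjacent twins. They have equal values, and values
  -- on `C` are distinct.
  C-twins : ∀ {u v} → C u ≡ true → C v ≡ true →
    (∀ w → C w ≡ false → NA H u w ≡ NA H v w) → u ≡ v
  C-twins {u} {v} cu cv same with u ≟ v
  ... | yes u≡v = u≡v
  ... | no u≢v  = distinct-H cu cv (D-twins H s (C-adjacent cu cv u≢v) λ w w≢u w≢v →
                    agree w w≢u w≢v (C w) refl)
    where
    agree : ∀ w → w ≢ u → w ≢ v → ∀ b → C w ≡ b → adj H u w ≡ adj H v w
    agree w w≢u w≢v true  c = trans (C-adjacent cu c (w≢u ∘ sym)) (sym (C-adjacent cv c (w≢v ∘ sym)))
    agree w w≢u w≢v false c = trans (adj-NA H (w≢u ∘ sym)) (trans (cong not (same w c)) (sym (adj-NA H (w≢v ∘ sym))))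

  attained : ∀ (k : Fin (suc rest)) → ∃ λ j → C j ≡ true × D H s j ≡ level (toℕ k)
  attained k = level-attained (rest ∸ toℕ k) (toℕ k) (m+[n∸m]≡n (s≤s⁻¹ (toℕ<n k)))

  top : Fin (suc rest) → Fin (suc n)
  top k = proj₁ (attained k)

  top-C : ∀ k → C (top k) ≡ true
  top-C k = proj₁ (proj₂ (attained k))

  top-injective : ∀ {k l} → top k ≡ top l → k ≡ l
  top-injective {k} {l} e = toℕ-injective (level-injective (trans (sym (proj₂ (proj₂ (attained k))))
    (trans (cong (D H s) e) (proj₂ (proj₂ (attained l))))))

  |R| : ℕ
  |R| = sum λ j → ⟦ not (C j) ⟧

  |R|≤ : |R| ≤ suc s
  |R|≤ = +-cancelˡ-≤ (suc rest) |R| (suc s) (begin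
    suc rest + |R|                            ≤⟨ +-monoˡ-≤ |R| (injection⇒≤ C top top-C top-injective) ⟩
    sum (λ j → ⟦ C j ⟧) + |R|                 ≡⟨ ∑-distrib-+ (λ j → ⟦ C j ⟧) (λ j → ⟦ not (C j) ⟧) ⟨
    sum (λ j → ⟦ C j ⟧ + ⟦ not (C j) ⟧)       ≡⟨ sum-cong-≗ (λ j → ⟦not⟧ (C j)) ⟩
    sum {suc n} (λ _ → 1)                     ≡⟨ trans (sum-const (suc n) 1) (*-identityʳ (suc n)) ⟩
    suc n                                     ≡⟨ cong suc (trans order (+-comm (suc s) rest)) ⟩
    suc rest + suc s                          ∎)
    where open ≤-Reasoning

  outer : Fin |R| → Fin (suc n)
  outer = proj₁ (enumerate (not ∘ C))

  outer-onto : ∀ {u v} → C u ≡ true → NA H u v ≡ true → ∃ λ k → outer k ≡ v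
  outer-onto {v = v} cu na = proj₂ (enumerate (not ∘ C)) v
    (cong not (¬-not λ cv → C-complete cu cv na))

  top-nonDegree : ∀ k → nonDegree H (top k) ≡ q
  top-nonDegree k = nonDegree-H (top-C k)

  q≢0 : q ≢ 0
  q≢0 e = no-dominating z (trans (nonDegree-G z∈C) e)

  top-nonneighbour : ∀ k → ∃ λ v → NA H (top k) v ≡ true
  top-nonneighbour k = let v , p = sum>0⇒∃ (λ v → ⟦ NA H (top k) v ⟧)
                                     (subst (0 <_) (sym (top-nonDegree k)) (n≢0⇒n>0 q≢0))
                       in v , ⟦⟧>0 p

  -- Words with one letter are not covered by `distinct-large-words`. Here the only non-neighbour,
  -- which lies outside `C`, determines the vertex, and `suc rest` vertices do not inject into at
  -- most `suc s`.
  one-nonneighbour : q ≡ 1 → ⊥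
  one-nonneighbour q≡1 = <⇒≱ s<rest (s≤s⁻¹ (≤-trans (injective⇒≤ {f = index} index-injective) |R|≤))
    where
    one : ∀ k → nonDegree H (top k) ≡ 1
    one k = trans (top-nonDegree k) q≡1
    found : ∀ k → ∃ λ x → outer x ≡ proj₁ (top-nonneighbour k)
    found k = outer-onto (top-C k) (proj₂ (top-nonneighbour k))
    index : Fin (suc rest) → Fin |R|
    index k = proj₁ (found k)
    transfer : ∀ k l → index k ≡ index l → ∀ w → NA H (top k) w ≡ true → NA H (top l) w ≡ true
    transfer k l e w na = subst (λ v → NA H (top l) v ≡ true)
      (trans (sym (proj₂ (found l))) (trans (cong outer (sym e)) (trans (proj₂ (found k))
        (nonDegree-unique H (one k) (proj₂ (top-nonneighbour k)) na))))
      (proj₂ (top-nonneighbour l))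
    index-injective : ∀ {k l} → index k ≡ index l → k ≡ l
    index-injective {k} {l} e = top-injective (C-twins (top-C k) (top-C l) λ w _ →
      ≡-by-⇔ (transfer k l e w) (transfer l k (sym e) w))

  -- If `|R|` is `suc s`, the `suc rest` words, the single letters and the empty word number
  -- `suc (suc n)`, while there are only 2 ^ `suc s` ≤ `suc n` words. For smaller `|R|`, adding d
  -- letters costs d single letters but creates at least d words.
  several-nonneighbours : 2 ≤ q → ⊥
  several-nonneighbours 2≤q = <-irrefl refl (begin-strict
    suc n + |R|                        ≡⟨ cong (λ m → suc m + |R|) order ⟩
    suc (suc s + rest) + |R|           <⟨ ≤-reflexive (regroup s rest |R|) ⟩
    suc (|R| + suc rest) + suc s       ≤⟨ +-monoˡ-≤ (suc s) (distinct-large-words word word-injective two) ⟩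
    2 ^ |R| + suc s                    ≡⟨ cong (2 ^ |R| +_) split ⟩
    2 ^ |R| + (d + |R|)                ≡⟨ swap (2 ^ |R|) d |R| ⟩
    d + 2 ^ |R| + |R|                  ≤⟨ +-monoˡ-≤ |R| (n+2^m≤2^[m+n] |R| d) ⟩
    2 ^ (|R| + d) + |R|                ≡⟨ cong (λ m → 2 ^ m + |R|) (trans (+-comm |R| d) (sym split)) ⟩
    2 ^ suc s + |R|                    ≤⟨ +-monoˡ-≤ |R| big ⟩
    suc n + |R|                        ∎)
    where
    open ≤-Reasoning
    d : ℕ
    d = suc s ∸ |R|
    split : suc s ≡ d + |R|
    split = sym (m∸n+n≡m |R|≤)
    regroup : ∀ s l m → suc (suc (suc s + l) + m) ≡ suc (m + suc l) + suc s
    regroup = solve-∀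
    swap : ∀ a b c → a + (b + c) ≡ b + a + c
    swap = solve-∀
    word : Fin (suc rest) → Fin |R| → Bool
    word k x = NA H (top k) (outer x)
    word-injective : ∀ {k l} → (∀ x → word k x ≡ word l x) → k ≡ l
    word-injective {k} {l} e = top-injective (C-twins (top-C k) (top-C l) λ w c →
      let x , ex = proj₂ (enumerate (not ∘ C)) w (cong not c)
      in subst (λ v → NA H (top k) v ≡ NA H (top l) v) ex (e x))
    two : ∀ k → ∃ λ x → ∃ λ y → x ≢ y × word k x ≡ true × word k y ≡ true
    two k =
      let v , na       = top-nonneighbour k
          w , w≢v , nb = nonDegree-another H (subst (2 ≤_) (sym (top-nonDegree k)) 2≤q) v
          x , ex       = outer-onto (top-C k) na
          y , ey       = outer-onto (top-C k) nb
      in x , y , (λ x≡y → w≢v (trans (sym ey) (trans (cong outer (sym x≡y)) ex)))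
           , trans (cong (NA H (top k)) ex) na , trans (cong (NA H (top k)) ey) nb

  impossible : ⊥
  impossible = by-cases q refl
    where
    by-cases : ∀ m → q ≡ m → ⊥
    by-cases zero          e = q≢0 e
    by-cases (suc zero)    e = one-nonneighbour e
    by-cases (suc (suc m)) e = several-nonneighbours (subst (2 ≤_) (sym e) (s≤s (s≤s z≤n)))

-- Degrees

≤ᵇ-split : ∀ b x → ⟦ b ≤ᵇ x ⟧ ≡ ⟦ suc b ≤ᵇ x ⟧ + ⟦ x ≡ᵇ b ⟧
≤ᵇ-split zero          zero    = refl
≤ᵇ-split zero          (suc x) = refl
≤ᵇ-split (suc b)       zero    = refl
≤ᵇ-split (suc zero)    (suc x) = ≤ᵇ-split zero x
≤ᵇ-split (suc (suc b)) (suc x) = ≤ᵇ-split (suc b) x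

suc≤ᵇsuc : ∀ b x → (suc b ≤ᵇ suc x) ≡ (b ≤ᵇ x)
suc≤ᵇsuc zero    x = refl
suc≤ᵇsuc (suc b) x = refl

one-value : ∀ {n} (P : Fin n → Bool) (f : Fin n → ℕ) a →
  sum (λ i → ⟦ P i ⟧ * ⟦ f i ≡ᵇ a ⟧) ≤ sum (⟦_⟧ ∘ P)
one-value P f a = sum-mono λ i → ≤-trans (*-monoʳ-≤ ⟦ P i ⟧ (⟦⟧≤1 (f i ≡ᵇ a))) (≤-reflexive (*-identityʳ _))

two-values : ∀ {n} (P : Fin n → Bool) (f : Fin n → ℕ) {a b} → a ≢ b →
  sum (λ i → ⟦ P i ⟧ * ⟦ f i ≡ᵇ a ⟧) + sum (λ i → ⟦ P i ⟧ * ⟦ f i ≡ᵇ b ⟧) ≤ sum (⟦_⟧ ∘ P)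
two-values P f {a} {b} a≢b = ≤-trans
  (≤-reflexive (sym (∑-distrib-+ (λ i → ⟦ P i ⟧ * ⟦ f i ≡ᵇ a ⟧) (λ i → ⟦ P i ⟧ * ⟦ f i ≡ᵇ b ⟧))))
  (sum-mono λ i → ≤-trans (≤-reflexive (sym (*-distribˡ-+ ⟦ P i ⟧ _ _)))
    (≤-trans (*-monoʳ-≤ ⟦ P i ⟧ (exclusive (f i))) (≤-reflexive (*-identityʳ _))))
  where
  exclusive : ∀ x → ⟦ x ≡ᵇ a ⟧ + ⟦ x ≡ᵇ b ⟧ ≤ 1
  exclusive x with x ≡ᵇ a in e | x ≡ᵇ b in e′
  ... | false | b     = ⟦⟧≤1 b
  ... | true  | false = ≤-refl
  ... | true  | true  = contradiction (trans (sym (≡ᵇ-sound x a e)) (≡ᵇ-sound x b e′)) a≢b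

degree-unique : ∀ {n} (X : Graph n) {j a b} → D X 1 j ≡ 1 → adj X j a ≡ true → adj X j b ≡ true → a ≡ b
degree-unique X {j} {a} {b} e ja jb with a ≟ b
... | yes a≡b = a≡b
... | no a≢b  = contradiction (≤-trans (≤-reflexive (cong₂ (λ x y → ⟦ x ⟧ + ⟦ y ⟧) (sym ja) (sym jb)))
                  (≤-trans (two-terms≤sum (λ u → ⟦ adj X j u ⟧) a≢b) (≤-reflexive (trans (sym (degree X j)) e))))
                  λ { (s≤s ()) }

neighbours-with : ∀ {n} → Graph n → ℕ → Fin n → ℕ
neighbours-with X a i = sum λ j → ⟦ adj X i j ⟧ * ⟦ D X 1 j ≡ᵇ a ⟧

vertices-with : ∀ {n} → Graph n → ℕ → ℕ
vertices-with X a = sum λ j → ⟦ D X 1 j ≡ᵇ a ⟧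

vertices-above : ∀ {n} → Graph n → ℕ → ℕ
vertices-above X a = sum λ j → ⟦ a ≤ᵇ D X 1 j ⟧

card-above : ∀ {n} → Graph n → ℕ → Fin n → ℕ
card-above X a i = sum λ j → ⟦ j ≠ᵇ i ⟧ * ⟦ a ≤ᵇ D∖ X i 1 j ⟧

-- Deleting i removes i itself from the count and also those neighbours of i whose degree is exactly
-- a.
card-above-eq : ∀ {n} (X : Graph n) a i →
  vertices-above X a ≡ ⟦ a ≤ᵇ D X 1 i ⟧ + (card-above X a i + neighbours-with X a i)
card-above-eq X a i = trans (sum-split i (λ j → ⟦ a ≤ᵇ D X 1 j ⟧)) (cong (⟦ a ≤ᵇ D X 1 i ⟧ +_)
  (trans (sum-cong-≗ drop) (∑-distrib-+ (λ j → ⟦ j ≠ᵇ i ⟧ * ⟦ a ≤ᵇ D∖ X i 1 j ⟧)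
                                        (λ j → ⟦ adj X i j ⟧ * ⟦ D X 1 j ≡ᵇ a ⟧))))
  where
  drop-adjacent : ∀ x → ⟦ a ≤ᵇ suc x ⟧ ≡ ⟦ a ≤ᵇ x ⟧ + ⟦ suc x ≡ᵇ a ⟧
  drop-adjacent x = go a
    where
    go : ∀ a → ⟦ a ≤ᵇ suc x ⟧ ≡ ⟦ a ≤ᵇ x ⟧ + ⟦ suc x ≡ᵇ a ⟧
    go zero    = refl
    go (suc a) = trans (cong ⟦_⟧ (suc≤ᵇsuc a x)) (≤ᵇ-split a x)
  drop : ∀ j → ⟦ j ≠ᵇ i ⟧ * ⟦ a ≤ᵇ D X 1 j ⟧ ≡
               ⟦ j ≠ᵇ i ⟧ * ⟦ a ≤ᵇ D∖ X i 1 j ⟧ + ⟦ adj X i j ⟧ * ⟦ D X 1 j ≡ᵇ a ⟧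
  drop j with j ≟ i
  ... | yes refl = sym (cong (λ b → ⟦ b ⟧ * ⟦ D X 1 j ≡ᵇ a ⟧) (adj-irref X j))
  ... | no _ = trans (+-identityʳ _) (trans (body (adj X i j) (trans (degree-∖ X i j)
                 (cong (λ b → D∖ X i 1 j + ⟦ b ⟧) (adj-sym X j i))))
                 (cong (_+ ⟦ adj X i j ⟧ * ⟦ D X 1 j ≡ᵇ a ⟧) (sym (+-identityʳ _))))
    where
    body : ∀ b → D X 1 j ≡ D∖ X i 1 j + ⟦ b ⟧ →
      ⟦ a ≤ᵇ D X 1 j ⟧ ≡ ⟦ a ≤ᵇ D∖ X i 1 j ⟧ + ⟦ b ⟧ * ⟦ D X 1 j ≡ᵇ a ⟧
    body false e = trans (cong (λ d → ⟦ a ≤ᵇ d ⟧) (trans e (+-identityʳ _))) (sym (+-identityʳ _))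
    body true  e = trans (cong (λ d → ⟦ a ≤ᵇ d ⟧) e′) (trans (drop-adjacent (D∖ X i 1 j))
      (cong (⟦ a ≤ᵇ D∖ X i 1 j ⟧ +_) (trans (cong (λ d → ⟦ d ≡ᵇ a ⟧) (sym e′)) (sym (+-identityʳ _)))))
      where
      e′ : D X 1 j ≡ suc (D∖ X i 1 j)
      e′ = trans e (+-comm (D∖ X i 1 j) 1)

neighbours-total : ∀ {n} (X : Graph n) a → sum (neighbours-with X a) ≡ a * vertices-with X a
neighbours-total {n} X a = begin
  sum (λ i → sum λ j → ⟦ adj X i j ⟧ * ⟦ D X 1 j ≡ᵇ a ⟧)
    ≡⟨ ∑-comm (λ i j → ⟦ adj X i j ⟧ * ⟦ D X 1 j ≡ᵇ a ⟧) ⟩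
  sum (λ j → sum λ i → ⟦ adj X i j ⟧ * ⟦ D X 1 j ≡ᵇ a ⟧)
    ≡⟨ sum-cong-≗ (λ j → trans (sum-cong-≗ λ i → cong (λ b → ⟦ b ⟧ * ⟦ D X 1 j ≡ᵇ a ⟧) (adj-sym X i j))
         (trans (sym (*-distribʳ-sum {n} ⟦ D X 1 j ≡ᵇ a ⟧ (λ i → ⟦ adj X j i ⟧)))
                (trans (cong (_* ⟦ D X 1 j ≡ᵇ a ⟧) (sym (degree X j))) (pointwise (D X 1 j))))) ⟩
  sum (λ j → a * ⟦ D X 1 j ≡ᵇ a ⟧)
    ≡⟨ *-distribˡ-sum {n} a (λ j → ⟦ D X 1 j ≡ᵇ a ⟧) ⟨
  a * vertices-with X a ∎
  where
  open ≡-Reasoning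
  pointwise : ∀ d → d * ⟦ d ≡ᵇ a ⟧ ≡ a * ⟦ d ≡ᵇ a ⟧
  pointwise d with d ≡ᵇ a in e
  ... | true  = cong (_* 1) (≡ᵇ-sound d a e)
  ... | false = trans (*-zeroʳ d) (sym (*-zeroʳ a))

-- The sum of `card-above-eq` over all vertices, less its instance at z, so that only the common
-- cards remain; it is arranged to avoid subtraction.
above-balance : ∀ {n} (X : Graph (suc n)) a z →
  sum (λ i → ⟦ i ≠ᵇ z ⟧ * card-above X a i) + vertices-above X a + a * vertices-with X a ≡
  n * vertices-above X a + neighbours-with X a z + ⟦ a ≤ᵇ D X 1 z ⟧
above-balance {n} X a z = +-cancelʳ-≡ (g + c z) _ _ (begin
  A + g + a * vertices-with X a + (g + c z)
    ≡⟨ rearrange A g (a * vertices-with X a) (c z) ⟩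
  g + ((c z + A) + a * vertices-with X a) + g
    ≡⟨ cong (λ x → g + (x + a * vertices-with X a) + g) (sum-split z c) ⟨
  g + (sum c + a * vertices-with X a) + g
    ≡⟨ cong (λ x → g + (sum c + x) + g) (neighbours-total X a) ⟨
  g + (sum c + sum (neighbours-with X a)) + g
    ≡⟨ cong (_+ g) all ⟩
  suc n * g + g
    ≡⟨ cong (suc n * g +_) (card-above-eq X a z) ⟩
  suc n * g + (⟦ a ≤ᵇ D X 1 z ⟧ + (c z + neighbours-with X a z))
    ≡⟨ finish n g ⟦ a ≤ᵇ D X 1 z ⟧ (c z) (neighbours-with X a z) ⟩
  n * g + neighbours-with X a z + ⟦ a ≤ᵇ D X 1 z ⟧ + (g + c z) ∎)
  where
  open ≡-Reasoning
  g : ℕ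
  g = vertices-above X a
  c : Fin (suc n) → ℕ
  c = card-above X a
  A : ℕ
  A = sum (λ i → ⟦ i ≠ᵇ z ⟧ * c i)
  rearrange : ∀ A g m c → A + g + m + (g + c) ≡ g + ((c + A) + m) + g
  rearrange = solve-∀
  finish : ∀ n g d c b → suc n * g + (d + (c + b)) ≡ n * g + b + d + (g + c)
  finish = solve-∀
  all : g + (sum c + sum (neighbours-with X a)) ≡ suc n * g
  all = trans (cong (g +_) (sym (∑-distrib-+ c (neighbours-with X a))))
    (trans (sym (∑-distrib-+ (λ i → ⟦ a ≤ᵇ D X 1 i ⟧) (λ i → c i + neighbours-with X a i)))
      (trans (sum-cong-≗ (λ i → sym (card-above-eq X a i))) (sum-const (suc n) g)))

card-degree : ∀ {n} {G H : Graph (suc n)} {z} → SameCards G H z → ∀ {i j} → i ≢ z → j ≢ i →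
  ∃ λ j′ → j′ ≢ i × D∖ H i 1 j′ ≡ D∖ G i 1 j
card-degree {G = G} {H} same {i} {j} i≢z j≢i =
  let j′ , j′≠i , _ , e = ⟦⟧*-witness (_≠ᵇ i) V (D∖ H i 1) (D∖ G i 1 j)
        (subst (0 <_) (card-sum same 1 (λ d _ → 1 * ⟦ d ≡ᵇ D∖ G i 1 j ⟧) i≢z)
          (⟦⟧*-positive (_≠ᵇ i) V (D∖ G i 1) (D∖ G i 1 j) {j} (≠ᵇ-true j≢i) refl refl))
  in j′ , ≠ᵇ⇒≢ j′≠i , e

-- This and the next four lemmas simplify instances of `equation-at`: degree 0 of z with b = 0,
-- degree 1 with b = 0, degrees 2 and 1 with b = 4 + k, and degree 1 with b in between.
balance₀ : ∀ k x y ζ → (6 + k) * x + (6 + k) * 0 + 0 + 0 * y + ζ + 1 * 0 ≡ (6 + k) * 1 + 2 * x + 1 * 0 →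
  (4 + k) * x + ζ ≡ 6 + k
balance₀ k x y ζ e = +-cancelʳ-≡ (2 * x) _ _ (trans (l k x y ζ) (trans e (r k x)))
  where
  l : ∀ k x y ζ → (4 + k) * x + ζ + 2 * x ≡ (6 + k) * x + (6 + k) * 0 + 0 + 0 * y + ζ + 1 * 0
  l = solve-∀
  r : ∀ k x → (6 + k) * 1 + 2 * x + 1 * 0 ≡ 6 + k + 2 * x
  r = solve-∀

balance₁ : ∀ k x y ν ζ →
  (6 + k) * x + (6 + k) * 1 + ν + 0 * y + ζ + 1 * 0 ≡ (6 + k) * 1 + 2 * x + 1 * 1 → (4 + k) * x + (ν + ζ) ≡ 1
balance₁ k x y ν ζ e = +-cancelʳ-≡ (2 * x + (6 + k)) _ _ (trans (l k x y ν ζ) (trans e (r k x)))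
  where
  l : ∀ k x y ν ζ → (4 + k) * x + (ν + ζ) + (2 * x + (6 + k)) ≡ (6 + k) * x + (6 + k) * 1 + ν + 0 * y + ζ + 1 * 0
  l = solve-∀
  r : ∀ k x → (6 + k) * 1 + 2 * x + 1 * 1 ≡ 1 + (2 * x + (6 + k))
  r = solve-∀

balance-top₂ : ∀ k x y ν → (6 + k) * x + (6 + k) * 0 + ν + (4 + k) * y + 0 + (5 + k) * 0 ≡
  (6 + k) * 1 + (6 + k) * x + (5 + k) * 0 → (4 + k) * y + ν ≡ 6 + k
balance-top₂ k x y ν e = +-cancelʳ-≡ ((6 + k) * x) _ _ (trans (l k x y ν) (trans e (r k x)))
  where
  l : ∀ k x y ν → (4 + k) * y + ν + (6 + k) * x ≡ (6 + k) * x + (6 + k) * 0 + ν + (4 + k) * y + 0 + (5 + k) * 0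
  l = solve-∀
  r : ∀ k x → (6 + k) * 1 + (6 + k) * x + (5 + k) * 0 ≡ 6 + k + (6 + k) * x
  r = solve-∀

balance-top₁ : ∀ k x y ν ζ → (6 + k) * x + (6 + k) * 0 + ν + (4 + k) * y + ζ + (5 + k) * 1 ≡
  (6 + k) * 1 + (6 + k) * x + (5 + k) * 0 → (4 + k) * y + (ν + ζ) ≡ 1
balance-top₁ k x y ν ζ e = +-cancelʳ-≡ ((6 + k) * x + (5 + k)) _ _ (trans (l k x y ν ζ) (trans e (r k x)))
  where
  l : ∀ k x y ν ζ → (4 + k) * y + (ν + ζ) + ((6 + k) * x + (5 + k)) ≡
                    (6 + k) * x + (6 + k) * 0 + ν + (4 + k) * y + ζ + (5 + k) * 1
  l = solve-∀
  r : ∀ k x → (6 + k) * 1 + (6 + k) * x + (5 + k) * 0 ≡ 1 + ((6 + k) * x + (5 + k))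
  r = solve-∀

balance-inner : ∀ k b c x y → 6 + k ≡ c + (2 + b) →
  (6 + k) * x + (6 + k) * 0 + 0 + b * y + 0 + suc b * 0 ≡ (6 + k) * 1 + (2 + b) * x + suc b * 0 →
  c * x + b * y ≡ 6 + k
balance-inner k b c x y d e = +-cancelʳ-≡ ((2 + b) * x) _ _ (trans (l c b x y)
  (trans (cong (λ m → m * x + b * y) (sym d)) (trans (l′ (6 + k) b x y) (trans e (r (6 + k) b x)))))
  where
  l : ∀ c b x y → c * x + b * y + (2 + b) * x ≡ (c + (2 + b)) * x + b * y
  l = solve-∀
  l′ : ∀ m b x y → m * x + b * y ≡ m * x + m * 0 + 0 + b * y + 0 + suc b * 0
  l′ = solve-∀
  r : ∀ m b x → m * 1 + (2 + b) * x + suc b * 0 ≡ m + (2 + b) * x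
  r = solve-∀

no-solution : ∀ k x y → (4 + k) * x + y ≡ 6 + k → x + y ≤ 2 → ⊥
no-solution k zero y e le = contradiction (≤-trans (≤-reflexive (sym e)) (≤-trans (≤-reflexive (cong (_+ y) (*-zeroʳ k))) le)) λ { (s≤s (s≤s ())) }
no-solution k (suc zero) y e le = contradiction
  (≤-trans (≤-reflexive (cong suc (sym (+-cancelˡ-≡ (4 + k) y 2 (trans (l k y) (trans e (+-comm 2 (4 + k)))))))) le) λ { (s≤s (s≤s ())) }
  where
  l : ∀ k y → 4 + k + y ≡ (4 + k) * 1 + y
  l = solve-∀
no-solution k (suc (suc x)) y e le = <-irrefl (sym e) (≤-trans (s≤s (m≤m+n (6 + k) (1 + k + (4 + k) * x + y)))
  (≤-reflexive (l k x y)))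
  where
  l : ∀ k x y → suc (6 + k + (1 + k + (4 + k) * x + y)) ≡ (4 + k) * suc (suc x) + y
  l = solve-∀

only-solution : ∀ k x y → (4 + k) * x + y ≡ 1 → x ≡ 0 × y ≡ 1
only-solution k zero    y e = refl , trans (cong (_+ y) (sym (*-zeroʳ k))) e
only-solution k (suc x) y e = case m+n≡0⇒n≡0 x (m+n≡0⇒m≡0 (x + (3 + k) * suc x) (cong pred e)) of λ ()

-- If x₁ is at least 2, the first equation forces k = 0, x₁ = 2 and x₂ = 0; the others then give x₃
-- = 3 and x₄ = 1.
few-solutions : ∀ k x₁ x₂ x₃ x₄ → 0 < x₁ → (3 + k) * x₁ + 1 * x₂ ≡ 6 + k →
  (2 + k) * x₂ + 2 * x₃ ≡ 6 + k → (1 + k) * x₃ + 3 * x₄ ≡ 6 + k → x₁ ≡ 1 ⊎ (k ≡ 0 × x₄ ≡ 1)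
few-solutions k (suc zero)    x₂ x₃ x₄ _ _ _ _ = inj₁ refl
few-solutions k (suc (suc x)) x₂ x₃ x₄ _ e₁ e₂ e₃ = inj₂ (k≡0 , solve₄ k x₂ x₃ x₄ k≡0 x₂≡0 e₂ e₃)
  where
  l : ∀ k x x₂ → k + ((3 + k) * x + x₂) + (6 + k) ≡ (3 + k) * suc (suc x) + 1 * x₂
  l = solve-∀
  zero-sum : k + ((3 + k) * x + x₂) ≡ 0
  zero-sum = +-cancelʳ-≡ (6 + k) _ 0 (trans (l k x x₂) e₁)
  k≡0 : k ≡ 0
  k≡0 = m+n≡0⇒m≡0 k zero-sum
  x₂≡0 : x₂ ≡ 0
  x₂≡0 = m+n≡0⇒n≡0 ((3 + k) * x) (m+n≡0⇒n≡0 k zero-sum)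
  solve₄ : ∀ k x₂ x₃ x₄ → k ≡ 0 → x₂ ≡ 0 → (2 + k) * x₂ + 2 * x₃ ≡ 6 + k →
    (1 + k) * x₃ + 3 * x₄ ≡ 6 + k → x₄ ≡ 1
  solve₄ _ _ x₃ x₄ refl refl e₂ e₃ with *-cancelˡ-≡ x₃ 3 2 e₂
  ... | refl = *-cancelˡ-≡ x₄ 1 3 (+-cancelˡ-≡ 3 _ _ e₃)

-- A shift of degrees with gap 1, where `rest` is 4 + k and n is 2 + `rest`. That k is a natural
-- number expresses that there are at least seven vertices.
module DegreeStep {n k} (n≡ : n ≡ 6 + k) {G H : Graph (suc n)} {z} (same : SameCards G H z)
                  (shifted : ∀ {j} → j ≢ z → D G 1 j ≡ suc (D H 1 j))
                  (missing : D H 1 z ≡ D G 1 z + (4 + k)) where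

  ≠z-cong : ∀ {f g : Fin (suc n) → ℕ} → (∀ {i} → i ≢ z → f i ≡ g i) →
    sum (λ i → ⟦ i ≠ᵇ z ⟧ * f i) ≡ sum (λ i → ⟦ i ≠ᵇ z ⟧ * g i)
  ≠z-cong e = sum-cong-≗ λ i → ⟦⟧*-cong (i ≠ᵇ z) λ i≠z → e (≠ᵇ⇒≢ {u = i} i≠z)

  opaque

    -- The vertices other than z are sorted by their degree in H, which determines the one in G. The
    -- corrections `ν` and `ζ` for z are small: by `t+nonDegree` it has at most two neighbours in G
    -- and at most two non-neighbours in H.
    η h ν ζ : ℕ → ℕ
    η b = sum λ i → ⟦ i ≠ᵇ z ⟧ * ⟦ D H 1 i ≡ᵇ b ⟧
    h b = sum λ i → ⟦ i ≠ᵇ z ⟧ * ⟦ b ≤ᵇ D H 1 i ⟧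
    ν a = neighbours-with G a z
    ζ a = sum λ i → ⟦ NA H z i ⟧ * ⟦ D H 1 i ≡ᵇ a ⟧

  opaque
    unfolding η

    above-G : ∀ b → vertices-above G (suc b) ≡ ⟦ suc b ≤ᵇ D G 1 z ⟧ + h b
    above-G b = trans (sum-split z (λ i → ⟦ suc b ≤ᵇ D G 1 i ⟧)) (cong (⟦ suc b ≤ᵇ D G 1 z ⟧ +_)
      (≠z-cong λ i≢z → cong ⟦_⟧ (trans (cong (suc b ≤ᵇ_) (shifted i≢z)) (suc≤ᵇsuc b _))))

    above-H : ∀ b → vertices-above H b ≡ ⟦ b ≤ᵇ D H 1 z ⟧ + h b
    above-H b = sum-split z (λ i → ⟦ b ≤ᵇ D H 1 i ⟧)

    h-split : ∀ b → h b ≡ h (suc b) + η b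
    h-split b = trans (sum-cong-≗ λ i → trans (cong (⟦ i ≠ᵇ z ⟧ *_) (≤ᵇ-split b (D H 1 i))) (*-distribˡ-+ ⟦ i ≠ᵇ z ⟧ ⟦ suc b ≤ᵇ D H 1 i ⟧ ⟦ D H 1 i ≡ᵇ b ⟧))
      (∑-distrib-+ (λ i → ⟦ i ≠ᵇ z ⟧ * ⟦ suc b ≤ᵇ D H 1 i ⟧) (λ i → ⟦ i ≠ᵇ z ⟧ * ⟦ D H 1 i ≡ᵇ b ⟧))

    with-G : ∀ b → vertices-with G (suc b) ≡ ⟦ D G 1 z ≡ᵇ suc b ⟧ + η b
    with-G b = trans (sum-split z (λ i → ⟦ D G 1 i ≡ᵇ suc b ⟧)) (cong (⟦ D G 1 z ≡ᵇ suc b ⟧ +_)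
      (≠z-cong λ i≢z → cong (λ d → ⟦ d ≡ᵇ suc b ⟧) (shifted i≢z)))

    with-H : ∀ b → vertices-with H b ≡ ⟦ D H 1 z ≡ᵇ b ⟧ + η b
    with-H b = sum-split z (λ i → ⟦ D H 1 i ≡ᵇ b ⟧)

    neighbours-H : ∀ a → neighbours-with H a z + ζ a ≡ η a
    neighbours-H a = trans (sym (∑-distrib-+ (λ i → ⟦ adj H z i ⟧ * ⟦ D H 1 i ≡ᵇ a ⟧) (λ i → ⟦ NA H z i ⟧ * ⟦ D H 1 i ≡ᵇ a ⟧)))
      (sum-cong-≗ λ i → trans (sym (*-distribʳ-+ ⟦ D H 1 i ≡ᵇ a ⟧ ⟦ adj H z i ⟧ ⟦ NA H z i ⟧))
        (cong (_* ⟦ D H 1 i ≡ᵇ a ⟧) (adj+NA H z i)))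

  opaque
    unfolding η

    cards-above : ∀ a → sum (λ i → ⟦ i ≠ᵇ z ⟧ * card-above G a i) ≡ sum (λ i → ⟦ i ≠ᵇ z ⟧ * card-above H a i)
    cards-above a = ≠z-cong λ i≢z → card-sum same 1 (λ d _ → ⟦ a ≤ᵇ d ⟧) i≢z

    balance : ∀ a →
      n * vertices-above G a + neighbours-with G a z + ⟦ a ≤ᵇ D G 1 z ⟧ + (vertices-above H a + a * vertices-with H a) ≡
      n * vertices-above H a + neighbours-with H a z + ⟦ a ≤ᵇ D H 1 z ⟧ + (vertices-above G a + a * vertices-with G a)
    balance a = trans (cong (_+ (vertices-above H a + a * vertices-with H a)) (sym (above-balance G a z)))
      (trans (cong (λ x → x + vertices-above G a + a * vertices-with G a + (vertices-above H a + a * vertices-with H a)) (cards-above a))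
        (trans (swap (sum (λ i → ⟦ i ≠ᵇ z ⟧ * card-above H a i)) (vertices-above G a) (a * vertices-with G a) (vertices-above H a) (a * vertices-with H a))
          (cong (_+ (vertices-above G a + a * vertices-with G a)) (above-balance H a z))))
      where
      swap : ∀ A g m g′ m′ → A + g + m + (g′ + m′) ≡ A + g′ + m′ + (g + m)
      swap = solve-∀

    -- In `balance` at `suc b` the numbers `h (suc b)` of vertices of larger degree cancel, and a
    -- relation between `η b` and `η (suc b)` remains.
    equation : ∀ {t} → D G 1 z ≡ t → ∀ b →
      n * η b + n * ⟦ suc b ≤ᵇ t ⟧ + ν (suc b) + b * η (suc b) + ζ (suc b) + suc b * ⟦ t + (4 + k) ≡ᵇ suc b ⟧ ≡
      n * ⟦ suc b ≤ᵇ t + (4 + k) ⟧ + (2 + b) * η b + suc b * ⟦ t ≡ᵇ suc b ⟧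
    equation {t} refl b = +-cancelʳ-≡ (n * x + τ + σ + x + η (suc b)) _ _ (begin
      n * e + n * τ + ν (suc b) + b * η (suc b) + ζ (suc b) + suc b * σ′ + (n * x + τ + σ + x + η (suc b))
        ≡⟨ left n b x e τ σ σ′ (ν (suc b)) (η (suc b)) (ζ (suc b)) ⟩
      n * (τ + (x + e)) + ν (suc b) + τ + ((σ + x) + suc b * (σ′ + η (suc b))) + ζ (suc b)
        ≡⟨ cong (_+ ζ (suc b)) main ⟩
      n * (σ + x) + ω + σ + ((τ + (x + e)) + suc b * (τ′ + e)) + ζ (suc b)
        ≡⟨ right n b x e τ σ τ′ ω (ζ (suc b)) ⟩
      n * σ + (2 + b) * e + suc b * τ′ + (n * x + τ + σ + x + (ω + ζ (suc b)))
        ≡⟨ cong (λ y → n * σ + (2 + b) * e + suc b * τ′ + (n * x + τ + σ + x + y)) (neighbours-H (suc b)) ⟩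
      n * σ + (2 + b) * e + suc b * τ′ + (n * x + τ + σ + x + η (suc b)) ∎)
      where
      open ≡-Reasoning
      x e τ σ τ′ σ′ ω : ℕ
      x  = h (suc b)
      e  = η b
      τ  = ⟦ suc b ≤ᵇ t ⟧
      σ  = ⟦ suc b ≤ᵇ t + (4 + k) ⟧
      τ′ = ⟦ t ≡ᵇ suc b ⟧
      σ′ = ⟦ t + (4 + k) ≡ᵇ suc b ⟧
      ω  = neighbours-with H (suc b) z
      gG : vertices-above G (suc b) ≡ τ + (x + e)
      gG = trans (above-G b) (cong (τ +_) (h-split b))
      gH : vertices-above H (suc b) ≡ σ + x
      gH = trans (above-H (suc b)) (cong (λ d → ⟦ suc b ≤ᵇ d ⟧ + x) missing)
      wH : vertices-with H (suc b) ≡ σ′ + η (suc b)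
      wH = trans (with-H (suc b)) (cong (λ d → ⟦ d ≡ᵇ suc b ⟧ + η (suc b)) missing)
      main : n * (τ + (x + e)) + ν (suc b) + τ + ((σ + x) + suc b * (σ′ + η (suc b))) ≡
             n * (σ + x) + ω + σ + ((τ + (x + e)) + suc b * (τ′ + e))
      main = trans (cong₂ (λ p q → n * p + ν (suc b) + τ + q) (sym gG)
                      (cong₂ (λ p q → p + suc b * q) (sym gH) (sym wH)))
        (trans (balance (suc b))
          (cong₂ _+_ (cong₂ (λ p q → n * p + ω + q) gH (cong (λ d → ⟦ suc b ≤ᵇ d ⟧) missing))
                     (cong₂ (λ p q → p + suc b * q) gG (with-G b))))
      left : ∀ n b x e τ σ σ′ ν y ζ →
        n * e + n * τ + ν + b * y + ζ + suc b * σ′ + (n * x + τ + σ + x + y) ≡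
        n * (τ + (x + e)) + ν + τ + ((σ + x) + suc b * (σ′ + y)) + ζ
      left = solve-∀
      right : ∀ n b x e τ σ τ′ ω ζ →
        n * (σ + x) + ω + σ + ((τ + (x + e)) + suc b * (τ′ + e)) + ζ ≡
        n * σ + (2 + b) * e + suc b * τ′ + (n * x + τ + σ + x + (ω + ζ))
      right = solve-∀

    equation-at : ∀ {t} → D G 1 z ≡ t → ∀ b {α β γ δ ν′ ζ′} →
      ⟦ suc b ≤ᵇ t ⟧ ≡ α → ⟦ t + (4 + k) ≡ᵇ suc b ⟧ ≡ β → ⟦ suc b ≤ᵇ t + (4 + k) ⟧ ≡ γ → ⟦ t ≡ᵇ suc b ⟧ ≡ δ →
      ν (suc b) ≡ ν′ → ζ (suc b) ≡ ζ′ →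
      (6 + k) * η b + (6 + k) * α + ν′ + b * η (suc b) + ζ′ + suc b * β ≡ (6 + k) * γ + (2 + b) * η b + suc b * δ
    equation-at {t} t≡ b refl refl refl refl refl refl = subst
      (λ m → m * η b + m * ⟦ suc b ≤ᵇ t ⟧ + ν (suc b) + b * η (suc b) + ζ (suc b) + suc b * ⟦ t + (4 + k) ≡ᵇ suc b ⟧ ≡
             m * ⟦ suc b ≤ᵇ t + (4 + k) ⟧ + (2 + b) * η b + suc b * ⟦ t ≡ᵇ suc b ⟧) n≡ (equation t≡ b)

  ≤ᵇ-true : ∀ {a b} → a ≤ b → ⟦ a ≤ᵇ b ⟧ ≡ 1
  ≤ᵇ-true le = cong ⟦_⟧ (Equivalence.to T-≡ (≤⇒≤ᵇ le))

  t+nonDegree : ∀ {t} → D G 1 z ≡ t → t + nonDegree H z ≡ 2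
  t+nonDegree {t} refl = +-cancelʳ-≡ (4 + k) _ 2 (begin
    t + nonDegree H z + (4 + k)   ≡⟨ swap t (nonDegree H z) (4 + k) ⟩
    t + (4 + k) + nonDegree H z   ≡⟨ cong (_+ nonDegree H z) missing ⟨
    D H 1 z + nonDegree H z       ≡⟨ trans (degree+nonDegree H z) n≡ ⟩
    6 + k                         ∎)
    where
    open ≡-Reasoning
    swap : ∀ a b c → a + b + c ≡ a + c + b
    swap = solve-∀

  opaque
    unfolding η

    ν≤ : ∀ a → ν a ≤ D G 1 z
    ν≤ a = subst (ν a ≤_) (sym (degree G z)) (one-value (adj G z) (D G 1) a)

    ν+ν≤ : ∀ {a b} → a ≢ b → ν a + ν b ≤ D G 1 z
    ν+ν≤ {a} {b} a≢b = subst (ν a + ν b ≤_) (sym (degree G z)) (two-values (adj G z) (D G 1) a≢b)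

    ζ≤ : ∀ a → ζ a ≤ nonDegree H z
    ζ≤ a = one-value (NA H z) (D H 1) a

    ζ+ζ≤ : ∀ {a b} → a ≢ b → ζ a + ζ b ≤ nonDegree H z
    ζ+ζ≤ a≢b = two-values (NA H z) (D H 1) a≢b

    dominating : η (5 + k) ≤ ν (6 + k)
    dominating = sum-mono λ i → ⟦≠ᵇ⟧*-≤ i z λ i≢z → bound i i≢z (D H 1 i ≡ᵇ (5 + k)) refl
      where
      bound : ∀ i → i ≢ z → ∀ b → (D H 1 i ≡ᵇ (5 + k)) ≡ b → ⟦ b ⟧ ≤ ⟦ adj G z i ⟧ * ⟦ D G 1 i ≡ᵇ (6 + k) ⟧
      bound i i≢z false e = z≤n
      bound i i≢z true  e = ≤-reflexive (sym (cong₂ (λ a b → ⟦ a ⟧ * ⟦ b ⟧)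
        (¬NA⇒adjacent G (i≢z ∘ sym) (trans (NA-sym G z i) (⟦⟧≡0 (sum≡0⇒ (λ u → ⟦ NA G i u ⟧) none z))))
        (trans (cong (_≡ᵇ (6 + k)) full) (≡ᵇ-refl (6 + k)))))
        where
        full : D G 1 i ≡ 6 + k
        full = trans (shifted i≢z) (cong suc (≡ᵇ-sound _ _ e))
        none : nonDegree G i ≡ 0
        none = +-cancelˡ-≡ (6 + k) _ 0 (trans (trans (cong (_+ nonDegree G i) (sym full)) (degree+nonDegree G i))
                 (trans n≡ (sym (+-identityʳ (6 + k)))))

  -- Neighbours of z in H have positive degree. So `η 0` and `ζ 1` count disjoint sets among the two
  -- non-neighbours of z in H, too few for the equation at b = 0.
  not-0 : D G 1 z ≢ 0
  not-0 t≡0 = no-solution k (η 0) (ζ 1)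
    (balance₀ k (η 0) (η 1) (ζ 1) (equation-at t≡0 0 refl refl refl refl (n≤0⇒n≡0 (subst (ν 1 ≤_) t≡0 (ν≤ 1))) refl))
    (subst₂ _≤_ (cong (_+ ζ 1) (trans (cong (_+ ζ 0) (sym no-neighbour)) (neighbours-H 0))) (t+nonDegree t≡0)
      (ζ+ζ≤ {0} {1} λ ()))
    where
    no-neighbour : neighbours-with H 0 z ≡ 0
    no-neighbour = sum-zero λ i → trans (⟦⟧*-cong (adj H z i) λ zi →
      cong ⟦_⟧ (≡ᵇ-false (>⇒≢ (≤-trans (≤-reflexive (sym (cong ⟦_⟧ (trans (adj-sym H i z) zi))))
        (subst (⟦ adj H i z ⟧ ≤_) (sym (degree H i)) (term≤sum (λ u → ⟦ adj H i u ⟧) z))))))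
      (*-zeroʳ ⟦ adj H z i ⟧)

  -- Complementary to `not-0`: a vertex of degree 5 + k in H other than z is dominating in G. So
  -- `η (5 + k)` and `ν (5 + k)` are bounded together by the two neighbours of z in G.
  not-2 : D G 1 z ≢ 2
  not-2 t≡2 = no-solution k (η (5 + k)) (ν (5 + k))
    (balance-top₂ k (η (4 + k)) (η (5 + k)) (ν (5 + k)) (equation-at t≡2 (4 + k) refl
      (cong ⟦_⟧ (≡ᵇ-false {6 + k} {5 + k} λ e → 1+n≢n e)) (≤ᵇ-true (n≤1+n (5 + k))) refl refl
      (n≤0⇒n≡0 (subst (ζ (5 + k) ≤_) (+-cancelˡ-≡ 2 _ 0 (t+nonDegree t≡2)) (ζ≤ (5 + k))))))
    (≤-trans (+-monoˡ-≤ (ν (5 + k)) dominating) (subst (ν (6 + k) + ν (5 + k) ≤_) t≡2 (ν+ν≤ (1+n≢n {5 + k}))))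

  module _ (t≡1 : D G 1 z ≡ 1) where

    H-z : D H 1 z ≡ 5 + k
    H-z = trans missing (cong (_+ (4 + k)) t≡1)

    one-nonneighbour : nonDegree H z ≡ 1
    one-nonneighbour = +-cancelˡ-≡ 1 _ 1 (t+nonDegree t≡1)

    ζ+ζ≤1 : ∀ {a b} → a ≢ b → ζ a + ζ b ≤ 1
    ζ+ζ≤1 {a} {b} a≢b = subst (ζ a + ζ b ≤_) one-nonneighbour (ζ+ζ≤ a≢b)

    ν+ν≤1 : ∀ {a b} → a ≢ b → ν a + ν b ≤ 1
    ν+ν≤1 {a} {b} a≢b = subst (ν a + ν b ≤_) t≡1 (ν+ν≤ a≢b)

    opaque
      unfolding η

      ν≤η : ∀ b → ν (suc b) ≤ η b
      ν≤η b = sum-mono λ i → bound i (adj G z i) refl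
        where
        bound : ∀ i a → adj G z i ≡ a → ⟦ a ⟧ * ⟦ D G 1 i ≡ᵇ suc b ⟧ ≤ ⟦ i ≠ᵇ z ⟧ * ⟦ D H 1 i ≡ᵇ b ⟧
        bound i false e = z≤n
        bound i true  e = ≤-reflexive (sym (cong₂ (λ a d → ⟦ a ⟧ * ⟦ d ⟧)
          (≠ᵇ-true i≢z) (cong (_≡ᵇ suc b) (sym (shifted i≢z)))))
          where
          i≢z : i ≢ z
          i≢z refl = adj-irref G i by e

    ζ≤η : ∀ b → ζ b ≤ η b
    ζ≤η b = subst (ζ b ≤_) (neighbours-H b) (m≤n+m (ζ b) (neighbours-with H b z))

    -- With `ζ₁`, the lowest equation shows that the only non-neighbour of z in H has degree 1.
    -- Dually, `high` shows that the only neighbour of z in G has degree 5 + k.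
    low : η 0 ≡ 0 × ν 1 + ζ 1 ≡ 1
    low = only-solution k (η 0) (ν 1 + ζ 1)
      (balance₁ k (η 0) (η 1) (ν 1) (ζ 1) (equation-at t≡1 0 refl refl refl refl refl refl))

    ζ₁ : ζ 1 ≡ 1
    ζ₁ = trans (cong (_+ ζ 1) (sym (n≤0⇒n≡0 (subst (ν 1 ≤_) (proj₁ low) (ν≤η 0))))) (proj₂ low)

    ζ≡0 : ∀ {a} → a ≢ 1 → ζ a ≡ 0
    ζ≡0 {a} a≢1 = n≤0⇒n≡0 (+-cancelʳ-≤ 1 _ 0 (subst (λ x → ζ a + x ≤ 1) ζ₁ (ζ+ζ≤1 a≢1)))

    high : η (5 + k) ≡ 0 × ν (5 + k) ≡ 1
    high = let y , e = only-solution k (η (5 + k)) (ν (5 + k) + 0)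
                 (balance-top₁ k (η (4 + k)) (η (5 + k)) (ν (5 + k)) 0
                   (equation-at t≡1 (4 + k) refl (cong ⟦_⟧ (≡ᵇ-refl (5 + k))) (≤ᵇ-true (≤-refl {5 + k})) refl refl
                     (ζ≡0 {5 + k} λ ())))
           in y , trans (sym (+-identityʳ _)) e

    ν≡0 : ∀ {a} → a ≢ 5 + k → ν a ≡ 0
    ν≡0 {a} a≢ = n≤0⇒n≡0 (+-cancelʳ-≤ 1 _ 0 (subst (λ x → ν a + x ≤ 1) (proj₂ high) (ν+ν≤1 a≢)))

    opaque
      unfolding η

      unique-H : ∀ {b} → η b ≡ 1 → ∀ {i j} → i ≢ z → j ≢ z → D H 1 i ≡ b → D H 1 j ≡ b → i ≡ j
      unique-H {b} η≡1 {i} {j} i≢z j≢z ei ej with i ≟ j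
      ... | yes i≡j = i≡j
      ... | no i≢j  = contradiction (≤-trans (≤-reflexive (sym (cong₂ _+_ (one i≢z ei) (one j≢z ej))))
                        (≤-trans (two-terms≤sum (λ i → ⟦ i ≠ᵇ z ⟧ * ⟦ D H 1 i ≡ᵇ b ⟧) i≢j) (≤-reflexive η≡1)))
                        λ { (s≤s ()) }
        where
        one : ∀ {i} → i ≢ z → D H 1 i ≡ b → ⟦ i ≠ᵇ z ⟧ * ⟦ D H 1 i ≡ᵇ b ⟧ ≡ 1
        one i≢z refl = cong₂ (λ a d → ⟦ a ⟧ * ⟦ d ⟧) (≠ᵇ-true i≢z) (≡ᵇ-refl b)

      absent : ∀ {b} → η b ≡ 0 → ∀ {i} → i ≢ z → D H 1 i ≢ b
      absent {b} η≡0 {i} i≢z refl = case trans (sym (sum≡0⇒ (λ i → ⟦ i ≠ᵇ z ⟧ * ⟦ D H 1 i ≡ᵇ b ⟧) η≡0 i))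
        (cong₂ (λ a d → ⟦ a ⟧ * ⟦ d ⟧) (≠ᵇ-true i≢z) (≡ᵇ-refl b)) of λ ()

    opaque
      unfolding η

      nonneighbour-v : ∃ λ v → NA H z v ≡ true × D H 1 v ≡ 1
      nonneighbour-v =
        let v , p = sum>0⇒∃ (λ i → ⟦ NA H z i ⟧ * ⟦ D H 1 i ≡ᵇ 1 ⟧) (subst (0 <_) (sym ζ₁) z<s)
        in v , ⟦⟧>0 (proj₁ (*-pos {⟦ NA H z v ⟧} p)) , ≡ᵇ-sound _ 1 (⟦⟧>0 (proj₂ (*-pos {⟦ NA H z v ⟧} p)))

      neighbour-w : ∃ λ w → adj G z w ≡ true × D G 1 w ≡ 5 + k
      neighbour-w =
        let w , p = sum>0⇒∃ (λ i → ⟦ adj G z i ⟧ * ⟦ D G 1 i ≡ᵇ (5 + k) ⟧) (subst (0 <_) (sym (proj₂ high)) z<s)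
        in w , ⟦⟧>0 (proj₁ (*-pos {⟦ adj G z w ⟧} p)) , ≡ᵇ-sound _ (5 + k) (⟦⟧>0 (proj₂ (*-pos {⟦ adj G z w ⟧} p)))

    -- v is the non-neighbour of z in H, and w is the neighbour of z in G.
    v w : Fin (suc n)
    v = proj₁ nonneighbour-v
    w = proj₁ neighbour-w

    zv : NA H z v ≡ true
    zv = proj₁ (proj₂ nonneighbour-v)

    zw : adj G z w ≡ true
    zw = proj₁ (proj₂ neighbour-w)

    v≢z : v ≢ z
    v≢z = NA-irrefl H zv ∘ sym

    w≢z : w ≢ z
    w≢z e = adj-irref G z by subst (λ x → adj G z x ≡ true) e zw

    H-v : D H 1 v ≡ 1
    H-v = proj₂ (proj₂ nonneighbour-v)

    G-v : D G 1 v ≡ 2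
    G-v = trans (shifted v≢z) (cong suc H-v)

    G-w : D G 1 w ≡ 5 + k
    G-w = proj₂ (proj₂ neighbour-w)

    H-w : D H 1 w ≡ 4 + k
    H-w = cong pred (trans (sym (shifted w≢z)) G-w)

    w≢v : w ≢ v
    w≢v e = case trans (sym H-w) (trans (cong (D H 1) e) H-v) of λ ()

    lower : ∀ {m} (X : Graph m) {i j d} → D∖ X i 1 j ≡ d → ∀ b → adj X j i ≡ b → D X 1 j ≡ d + ⟦ b ⟧
    lower X {i} {j} e b a = trans (degree-∖ X i j) (cong₂ (λ d a → d + ⟦ a ⟧) e a)

    unlower-adjacent : ∀ {m} (X : Graph m) {i j d} → D X 1 j ≡ suc d → adj X j i ≡ true → D∖ X i 1 j ≡ d
    unlower-adjacent X {i} {j} {d} e a = +-cancelʳ-≡ 1 _ d (trans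
      (sym (trans (degree-∖ X i j) (cong (λ b → D∖ X i 1 j + ⟦ b ⟧) a))) (trans e (+-comm 1 d)))

    unlower-nonadjacent : ∀ {m} (X : Graph m) {i j d} → D X 1 j ≡ d → adj X j i ≡ false → D∖ X i 1 j ≡ d
    unlower-nonadjacent X e a = trans (D-∖-nonadjacent X 1 a) e

    -- The isolated vertex z of the card of G at w forces v and w to be adjacent
    -- in H, and then the card of H at v has no vertex of degree 1 to match z.
    one-leaf : η 1 ≡ 1 → ⊥
    one-leaf η₁ =
      let j , j≢w , ej = card-degree same w≢z (w≢z ∘ sym)
          ej′ = trans ej (unlower-adjacent G t≡1 zw)
          vw = adjacent-vw j (adj H j w) refl (lower H ej′ (adj H j w) refl)
          i , i≢v , ei = card-degree same v≢z (v≢z ∘ sym)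
          ei′ = trans ei (unlower-nonadjacent G t≡1 (¬-not λ zv′ → w≢v (degree-unique G t≡1 zw zv′)))
      in no-leaf vw i i≢v (adj H i v) refl (lower H ei′ (adj H i v) refl)
      where
      is-v : ∀ {j} → D H 1 j ≡ 1 → j ≡ v
      is-v {j} e = unique-H η₁ (λ { refl → case trans (sym e) H-z of λ () }) v≢z e H-v
      adjacent-vw : ∀ j b → adj H j w ≡ b → D H 1 j ≡ ⟦ b ⟧ → adj H v w ≡ true
      adjacent-vw j true  a e = subst (λ x → adj H x w ≡ true) (is-v e) a
      adjacent-vw j false a e =
        contradiction e (absent (proj₁ low) λ { refl → case trans (sym e) H-z of λ () })
      no-leaf : adj H v w ≡ true → ∀ i → i ≢ v → ∀ b → adj H i v ≡ b → D H 1 i ≡ 1 + ⟦ b ⟧ → ⊥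
      no-leaf vw i i≢v false a e = i≢v (is-v e)
      no-leaf vw i i≢v true  a e = case trans (sym e) (trans (cong (D H 1)
        (degree-unique H H-v (trans (adj-sym H v i) a) vw)) H-w) of λ ()

    -- The argument for one-leaf, applied to the complements of H and G.
    one-large : η (4 + k) ≡ 1 → ⊥
    one-large η₄ =
      let j , j≢v , ej = card-degree (SameCards-sym same) v≢z (v≢z ∘ sym)
          ej′ = trans ej (unlower-nonadjacent H H-z (NA⇒nonadjacent H zv))
          wv = nonadjacent-wv j (adj G j v) refl (lower G ej′ (adj G j v) refl)
          i , i≢w , ei = card-degree (SameCards-sym same) w≢z (w≢z ∘ sym)
          ei′ = trans ei (unlower-adjacent H H-z (¬NA⇒adjacent H (w≢z ∘ sym) (¬-not λ zw′ →
                  w≢v (nonDegree-unique H one-nonneighbour zw′ zv))))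
      in no-large wv i i≢w (adj G i w) refl (lower G ei′ (adj G i w) refl)
      where
      one-nonneighbour-w : nonDegree G w ≡ 1
      one-nonneighbour-w = +-cancelˡ-≡ (5 + k) _ 1 (trans (trans (cong (_+ nonDegree G w) (sym G-w)) (trans (degree+nonDegree G w) n≡))
                             (+-comm 1 (5 + k)))
      is-w : ∀ {j} → D G 1 j ≡ 5 + k → j ≡ w
      is-w {j} e = unique-H η₄ j≢z w≢z (cong pred (trans (sym (shifted j≢z)) e)) H-w
        where
        j≢z : j ≢ z
        j≢z refl = case trans (sym e) t≡1 of λ ()
      nonadjacent-wv : ∀ j b → adj G j v ≡ b → D G 1 j ≡ 5 + k + ⟦ b ⟧ → NA G w v ≡ true
      nonadjacent-wv j false a e = nonadjacent⇒NA G w≢v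
        (subst (λ x → adj G x v ≡ false) (is-w (trans e (+-identityʳ _))) a)
      nonadjacent-wv j true  a e = contradiction
        (cong pred (trans (sym (shifted j≢z)) (trans e (+-comm (5 + k) 1)))) (absent (proj₁ high) j≢z)
        where
        j≢z : j ≢ z
        j≢z refl = case trans (sym e) t≡1 of λ ()
      no-large : NA G w v ≡ true → ∀ i → i ≢ w → ∀ b → adj G i w ≡ b → D G 1 i ≡ 4 + k + ⟦ b ⟧ → ⊥
      no-large wv i i≢w true  a e = i≢w (is-w (trans e (+-comm (4 + k) 1)))
      no-large wv i i≢w false a e = case trans (sym e) (trans (cong (D G 1)
        (nonDegree-unique G one-nonneighbour-w (nonadjacent⇒NA G (i≢w ∘ sym) (trans (adj-sym G w i) a)) wv)) G-v) of λ ()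

    -- Strictly between the extreme degrees z does not interfere: `ν` and `ζ` vanish, and of the
    -- indicators only that of `suc b` ≤ 5 + k survives. The coefficient c is 4 + k - b.
    inner : ∀ b c → suc b ≢ 1 → suc b ≢ 5 + k → 6 + k ≡ c + (2 + b) → b < 4 + k → 0 < b → c * η b + b * η (suc b) ≡ 6 + k
    inner b c b≢0 b≢ e b< 0<b = balance-inner k b c (η b) (η (suc b)) e
      (equation-at t≡1 b (cong ⟦_⟧ (¬-not λ le → b≢0 (cong suc (n≤0⇒n≡0 (s≤s⁻¹ (≤ᵇ⇒≤ (suc b) 1 (Equivalence.from T-≡ le)))))))
        (cong ⟦_⟧ (≡ᵇ-false (b≢ ∘ sym))) (≤ᵇ-true (s≤s (<⇒≤ b<))) (cong ⟦_⟧ (≡ᵇ-false {1} {suc b} (b≢0 ∘ sym)))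
        (ν≡0 b≢) (ζ≡0 b≢0))

    not-1 : ⊥
    not-1 = by-cases (few-solutions k (η 1) (η 2) (η 3) (η 4) (≤-trans (≤-reflexive (sym ζ₁)) (ζ≤η 1))
      (inner 1 (3 + k) (λ ()) (λ ()) (+-comm 3 (3 + k)) (s≤s (s≤s z≤n)) z<s)
      (inner 2 (2 + k) (λ ()) (λ ()) (+-comm 4 (2 + k)) (s≤s (s≤s (s≤s z≤n))) z<s)
      (inner 3 (1 + k) (λ ()) (λ ()) (+-comm 5 (1 + k)) (s≤s (s≤s (s≤s (s≤s z≤n)))) z<s))
      where
      by-cases : η 1 ≡ 1 ⊎ (k ≡ 0 × η 4 ≡ 1) → ⊥
      by-cases (inj₁ η₁)         = one-leaf η₁
      by-cases (inj₂ (k≡0 , η₄)) = one-large (subst (λ m → η (4 + m) ≡ 1) (sym k≡0) η₄)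

  impossible : ⊥
  impossible = by-cases (D G 1 z) refl
    where
    by-cases : ∀ t → D G 1 z ≡ t → ⊥
    by-cases 0 e = not-0 e
    by-cases 1 e = not-1 e
    by-cases 2 e = not-2 e
    by-cases (suc (suc (suc t))) e = case t+nonDegree e of λ ()

degree-shift-impossible : ∀ {n} {G H : Graph (suc n)} {z} → SameCards G H z → 6 ≤ n → Shift G H z 1 → ⊥
degree-shift-impossible {n} {G} {H} {z} same 6≤n shift = go gap≡1 (m≤n⇒∃[o]m+o≡n 4≤rest) order
  where
  open Shift shift
  4≤rest : 4 ≤ rest
  4≤rest = +-cancelˡ-≤ 2 4 rest (subst (6 ≤_) order 6≤n)
  rest*gap≤ : rest * gap ≤ 2 + rest
  rest*gap≤ = begin
    rest * gap                 ≤⟨ m≤n+m (rest * gap) (D G 1 z) ⟩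
    D G 1 z + rest * gap       ≡⟨ missing ⟨
    D H 1 z                    ≤⟨ m≤m+n (D H 1 z) (nonDegree H z) ⟩
    D H 1 z + nonDegree H z    ≡⟨ trans (degree+nonDegree H z) order ⟩
    2 + rest                   ∎
    where open ≤-Reasoning
  -- As `rest` ≥ 4, a gap of 2 or more would give z a degree above 2 + `rest` in H.
  gap≡1 : gap ≡ 1
  gap≡1 = ≤-antisym (≮⇒≥ λ 2≤gap → <⇒≱ (begin-strict
    2 + rest      <⟨ +-monoˡ-< rest (≤-trans (s≤s (s≤s (s≤s z≤n))) 4≤rest) ⟩
    rest + rest   ≡⟨ cong (rest +_) (+-identityʳ rest) ⟨
    2 * rest      ≡⟨ *-comm 2 rest ⟩
    rest * 2      ≤⟨ *-monoʳ-≤ rest 2≤gap ⟩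
    rest * gap    ∎) rest*gap≤) gap>0
    where open ≤-Reasoning
  go : gap ≡ 1 → (∃ λ k → 4 + k ≡ rest) → n ≡ 2 + rest → ⊥
  go gap≡1 (k , refl) refl = DegreeStep.impossible {k = k} refl {G} {H} {z} same
    (λ j≢z → trans (shifted j≢z) (trans (cong (D H 1 _ +_) gap≡1) (+-comm (D H 1 _) 1)))
    (trans missing (cong (D G 1 z +_) (trans (cong (rest *_) gap≡1) (*-identityʳ rest))))

-- Induction on the clique size and conclusion

module _ {n} {G H : Graph (suc (suc n))} {z} (same : SameCards G H z) (7≤ : 7 ≤ suc (suc n)) where

  sameD-step : ∀ s → 2 ^ suc s ≤ suc (suc n) → (∀ {t} → t < s → SameD G H t) → SameD G H s
  -- The bound on s required here comes from s + 2 ≤ 2 ^ `suc s`.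
  sameD-step s big ih with sameD-or-shift same s (s≤s⁻¹ (≤-trans (≤-trans (≤-reflexive (+-comm 1 (suc s)))
                             (n+2^m≤2^[m+n] 0 (suc s))) big))
  ... | inj₁ eq = eq
  sameD-step 0 big ih | inj₂ _ = λ j → trans (D-κ G 0 j) (sym (D-κ H 0 j))
  sameD-step 1 big ih | inj₂ (inj₁ shift) = contradiction (degree-shift-impossible same (s≤s⁻¹ 7≤) shift) λ ()
  sameD-step 1 big ih | inj₂ (inj₂ shift) =
    contradiction (degree-shift-impossible (SameCards-sym same) (s≤s⁻¹ 7≤) shift) λ ()
  sameD-step s@(suc (suc _)) big ih | inj₂ (inj₁ shift) =
    contradiction (Step.impossible same s (s≤s (s≤s z≤n)) ih big shift) λ ()
  sameD-step s@(suc (suc _)) big ih | inj₂ (inj₂ shift) =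
    contradiction (Step.impossible (SameCards-sym same) s (s≤s (s≤s z≤n)) (λ t<s j → sym (ih t<s j)) big shift) λ ()

  sameD-below : ∀ s → 2 ^ s ≤ suc (suc n) → ∀ {t} → t < s → SameD G H t
  sameD-below (suc s) big {t} t<s with m≤n⇒m<n∨m≡n (s≤s⁻¹ t<s)
  ... | inj₁ t<s′ = sameD-below s (≤-trans (m≤m+n (2 ^ s) _) big) t<s′
  ... | inj₂ refl = sameD-step s big (sameD-below s (≤-trans (m≤m+n (2 ^ s) _) big))

2^⌊log₂⌋≤ : ∀ r n → 1 ≤ n → r ≤ ⌊log₂ n ⌋ → 2 ^ r ≤ n
2^⌊log₂⌋≤ zero    n 1≤n _ = 1≤n
2^⌊log₂⌋≤ (suc r) 1 _ ()
2^⌊log₂⌋≤ (suc r) n@(suc (suc m)) _ r< = begin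
  2 * 2 ^ r            ≤⟨ *-monoʳ-≤ 2 (2^⌊log₂⌋≤ r ⌊ n /2⌋ (s≤s z≤n)
                            (subst (r ≤_) (sym (⌊log₂⌊n/2⌋⌋≡⌊log₂n⌋∸1 n)) (∸-monoˡ-≤ 1 r<))) ⟩
  2 * ⌊ n /2⌋          ≡⟨ cong (⌊ n /2⌋ +_) (+-identityʳ ⌊ n /2⌋) ⟩
  ⌊ n /2⌋ + ⌊ n /2⌋    ≤⟨ +-monoʳ-≤ ⌊ n /2⌋ (⌊n/2⌋≤⌈n/2⌉ n) ⟩
  ⌊ n /2⌋ + ⌈ n /2⌉    ≡⟨ ⌊n/2⌋+⌈n/2⌉≡n n ⟩
  n                    ∎
  where open ≤-Reasoning

theorem1p5 : ∀ {n : ℕ} (G : Graph n) (r : ℕ) → 7 ≤ n → 1 ≤ r → r ≤ ⌊log₂ n ⌋ →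
    ReconstructibleFrom (n ∸ 1) (cliqueCount r) G
theorem1p5 {1} G r (s≤s ())
theorem1p5 {suc (suc n)} G (suc s) 7≤n _ r≤log H common =
  let z , H′ , H′≅H , same = common-cards G H common
      sameD = sameD-below {H = H′} (sameCards same) 7≤n (suc s) (2^⌊log₂⌋≤ (suc s) (suc (suc n)) (s≤s z≤n) r≤log) ≤-refl
  in trans (sym (cliqueCount-iso H′≅H (suc s))) (*-cancelˡ-≡ _ _ (suc s !) {{suc s !≢0}} (begin
       suc s ! * cliqueCount (suc s) H′  ≡⟨ κ-cliqueCount H′ (suc s) ⟩
       κ H′ (suc s) V                    ≡⟨ κ-suc-V H′ s ⟩
       sum (D H′ s)                      ≡⟨ sum-cong-≗ sameD ⟨
       sum (D G s)                       ≡⟨ κ-suc-V G s ⟨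
       κ G (suc s) V                     ≡⟨ κ-cliqueCount G (suc s) ⟨
       suc s ! * cliqueCount (suc s) G   ∎))
  where open ≡-Reasoning
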